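{- Let $T$ be a tree of order $n\geq 8$ and let $\mu\neq 1$ be a Laplacian eigenvalue of $T$. Then $m_T(\mu)=\frac n2-2$ if and only if $T\cong T\left(\frac n2,\frac n2-1\right)$ and $\mu=\frac{3\pm\sqrt5}{2}$. In particular, in this case $\mu$ is the algebraic connectivity of $T$ or its conjugate.
   Context: For a graph on $n$ vertices, $0=\mu_1\leq\mu_2\leq\cdots\leq\mu_n$ denote the eigenvalues of its Laplacian matrix $L=D-A$ ($D$ the diagonal degree matrix, $A$ the adjacency matrix); $\mu_2$ is the algebraic connectivity, and $m_T(\mu)$ is the multiplicity of $\mu$. Two Laplacian eigenvalues are conjugates if they are roots of the same irreducible factor over $\mathbb{Q}$ of the characteristic polynomial of $L$. For integers $1\leq k\leq s$, the spider $T(s,k)$ is the tree obtained from the star $K_{1,s}$ by extending $k$ of its $s$ rays by one extra edge each ($s+k+1$ vertices). -}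

module Defs where

open import Level using (Level; _⊔_) renaming (suc to lsuc)
open import Algebra.Bundles using (CommutativeRing)
open import Data.Nat as ℕ using (ℕ; zero; suc; _≡ᵇ_; _≤ᵇ_) renaming (_+_ to _+ℕ_)
open import Data.Fin using (Fin; toℕ; inject₁; fromℕ)
  renaming (zero to fzero; suc to fsuc)
open import Data.Bool using (Bool; true; false; if_then_else_; _∧_; _∨_)
open import Data.Product using (Σ; ∃; _×_; _,_)
open import Data.Sum using (_⊎_)
open import Data.Empty using (⊥)
open import Relation.Nullary using (¬_)
open import Relation.Binary.PropositionalEquality using (_≡_)
open import Function.Definitions using (Injective)

record OrderedField (c ℓ : Level) : Set (lsuc (c ⊔ ℓ)) where
  field
    commutativeRing : CommutativeRing c ℓ
  open CommutativeRing commutativeRing public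
  field
    _<_        : Carrier → Carrier → Set ℓ
    0≉1        : ¬ (0# ≈ 1#)
    inverse    : ∀ x → ¬ (x ≈ 0#) → ∃ λ y → x * y ≈ 1#
    <-irrefl   : ∀ x → ¬ (x < x)
    <-trans    : ∀ {x y z} → x < y → y < z → x < z
    <-trichot  : ∀ x y → x < y ⊎ (x ≈ y ⊎ y < x)
    <-resp-≈   : ∀ {x x′ y y′} → x ≈ x′ → y ≈ y′ → x < y → x′ < y′
    +-mono-<   : ∀ {x y} z → x < y → (x + z) < (y + z)
    *-pos      : ∀ {x y} → 0# < x → 0# < y → 0# < (x * y)

  _≤_ : Carrier → Carrier → Set ℓ
  x ≤ y = ¬ (y < x)

  ι : ℕ → Carrier
  ι zero    = 0#
  ι (suc k) = 1# + ι k

  ∑ : ∀ {k} → (Fin k → Carrier) → Carrier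
  ∑ {zero}  f = 0#
  ∑ {suc k} f = f fzero + ∑ (λ i → f (fsuc i))

record Graph (n : ℕ) : Set where
  field
    adj    : Fin n → Fin n → Bool
    sym    : ∀ i j → adj i j ≡ adj j i
    irrefl : ∀ i → adj i i ≡ false
open Graph public

countℕ : ∀ {k} → (Fin k → Bool) → ℕ
countℕ {zero}  f = 0
countℕ {suc k} f = (if f fzero then 1 else 0) +ℕ countℕ (λ i → f (fsuc i))

degree : ∀ {n} → Graph n → Fin n → ℕ
degree G i = countℕ (adj G i)

data Walk {n : ℕ} (G : Graph n) : Fin n → Fin n → Set where
  here : ∀ {i} → Walk G i i
  step : ∀ {i j k} → adj G i j ≡ true → Walk G j k → Walk G i k

Connected : ∀ {n} → Graph n → Set
Connected G = ∀ i j → Walk G i j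

IsCycle : ∀ {n} → Graph n → (k : ℕ) → (Fin (suc (suc (suc k))) → Fin n) → Set
IsCycle G k c =
  Injective _≡_ _≡_ c ×
  (∀ (t : Fin (suc (suc k))) → adj G (c (inject₁ t)) (c (fsuc t)) ≡ true) ×
  adj G (c (fromℕ (suc (suc k)))) (c fzero) ≡ true

Acyclic : ∀ {n} → Graph n → Set
Acyclic G = ∀ k c → ¬ IsCycle G k c

IsTree : ∀ {n} → Graph n → Set
IsTree G = Connected G × Acyclic G

Iso : ∀ {n m} → (Fin n → Fin n → Bool) → (Fin m → Fin m → Bool) → Set
Iso {n} {m} A B =
  Σ (Fin n → Fin m) λ f → Σ (Fin m → Fin n) λ g →
    (∀ x → g (f x) ≡ x) × (∀ y → f (g y) ≡ y) ×
    (∀ i j → A i j ≡ B (f i) (f j))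

-- The spider T(s,k) on vertex set Fin (s + k + 1):
-- vertex 0 is the centre, vertices 1..s are the neighbours of the centre,
-- and vertex a+s (1 ≤ a ≤ k) is the extra pendant vertex attached to a.

spiderAdjℕ : ℕ → ℕ → ℕ → ℕ → Bool
spiderAdjℕ s k a b =
  ((a ≡ᵇ 0) ∧ (1 ≤ᵇ b) ∧ (b ≤ᵇ s)) ∨ ((1 ≤ᵇ a) ∧ (a ≤ᵇ k) ∧ (b ≡ᵇ (a +ℕ s)))

spiderAdj : (s k : ℕ) → Fin (s +ℕ k +ℕ 1) → Fin (s +ℕ k +ℕ 1) → Bool
spiderAdj s k i j = spiderAdjℕ s k (toℕ i) (toℕ j) ∨ spiderAdjℕ s k (toℕ j) (toℕ i)

module _ {c ℓ} (F : OrderedField c ℓ) where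
  open OrderedField F

  laplacianApply : ∀ {n} → Graph n → (Fin n → Carrier) → Fin n → Carrier
  laplacianApply G v i =
    (ι (degree G i) * v i) - ∑ (λ j → if adj G i j then v j else 0#)

  IsLapEigenvector : ∀ {n} → Graph n → Carrier → (Fin n → Carrier) → Set ℓ
  IsLapEigenvector G μ v = ∀ i → laplacianApply G v i ≈ μ * v i

  IsLapEigenvalue : ∀ {n} → Graph n → Carrier → Set (c ⊔ ℓ)
  IsLapEigenvalue {n} G μ =
    Σ (Fin n → Carrier) λ v → IsLapEigenvector G μ v × ¬ (∀ i → v i ≈ 0#)

  LinIndep : ∀ {n k} → (Fin k → Fin n → Carrier) → Set (c ⊔ ℓ)
  LinIndep {n} {k} vs =
    ∀ (a : Fin k → Carrier) → (∀ j → ∑ (λ i → a i * vs i j) ≈ 0#) → ∀ i → a i ≈ 0#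

  HasIndepEigenvectors : ∀ {n} → Graph n → Carrier → ℕ → Set (c ⊔ ℓ)
  HasIndepEigenvectors {n} G μ k =
    Σ (Fin k → Fin n → Carrier) λ vs → (∀ t → IsLapEigenvector G μ (vs t)) × LinIndep vs

  -- m_G(μ) = m : the eigenspace of μ has dimension exactly m
  -- (L is symmetric, so geometric = algebraic multiplicity)
  LapMultiplicity : ∀ {n} → Graph n → Carrier → ℕ → Set (c ⊔ ℓ)
  LapMultiplicity G μ m = HasIndepEigenvectors G μ m × ¬ HasIndepEigenvectors G μ (suc m)

  -- algebraic connectivity of a connected graph: its least positive
  -- Laplacian eigenvalue (= μ₂, since 0 is simple for connected graphs)
  IsAlgebraicConnectivity : ∀ {n} → Graph n → Carrier → Set (c ⊔ ℓ)
  IsAlgebraicConnectivity G λ₂ =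
    IsLapEigenvalue G λ₂ × 0# < λ₂ ×
    (∀ ν → IsLapEigenvalue G ν → 0# < ν → λ₂ ≤ ν)

{-# OPTIONS --safe #-}
-- Root the tree and eliminate L − μ from the leaves up (Jacobs–Locker). A vertex v whose children all have nonzero pivots
-- gets the pivot a(v) = d(v) − μ − Σ 1 / a(c); it is of kind Z if a(v) = 0 and of kind N otherwise. A vertex with a child
-- of kind Z is of kind P; eigenvectors vanish there, and it does not contribute to the pivot of its parent. An eigenvector
-- vanishing at all Z vertices except one chosen Z child of each P vertex is zero, so m ≤ |Z| − |P| and
-- n − 2m ≥ |N| + 3|P| − |Z|. As μ ≠ 1, leaves are of kind N, so each Z vertex has a child, and branches of kind N, Z, P
-- contribute at least 1, 0, 3 to the right-hand side; a contribution 0 occurs only for a path with two vertices, which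
-- forces μ² − 3μ + 1 = 0. With a root of degree at least 3 (without such a vertex the tree is a path and m ≤ 1), the value
-- 4 leaves only a root of kind P with one leaf and otherwise two-vertex paths below it: the spider.
--
-- Conversely, for μ² − 3μ + 1 = 0 differences of vectors supported on the long legs of the spider are eigenvectors. An
-- eigenvector for an eigenvalue strictly between 0 and the smaller root that is positive at the centre takes larger values
-- at all neighbours of the centre, contradicting the equation there; hence the smaller root is the algebraic connectivity.
module Submission where

open import Defs hiding (sym)
open import Algebra.Solver.Ring.AlmostCommutativeRing using (fromCommutativeRing; _-Raw-AlmostCommutative⟶_)
import Algebra.Solver.Ring
import Algebra.Properties.AbelianGroup
import Algebra.Properties.Ring
open import Data.Bool using (Bool; true; false; if_then_else_; _∨_; T)
import Data.Bool as Bool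
import Data.Bool.Properties as Boolₚ
open import Data.Empty using (⊥; ⊥-elim)
open import Data.Fin using (Fin; inject₁; fromℕ; toℕ; punchIn; splitAt) renaming (zero to fzero; suc to fsuc)
import Data.Fin as Fin
import Data.Fin.Properties as Finₚ
open import Data.Integer as ℤ using (ℤ; -[1+_])
import Data.Integer.Properties as ℤₚ
open import Data.List using (List; []; _∷_; _++_; map; length; filter; allFin; tabulate; take; lookup)
open import Data.List.Membership.Propositional using (_∈_; _∉_)
open import Data.List.Membership.Propositional.Properties using (∈-++⁺ˡ; ∈-++⁺ʳ; ∈-++⁻; ∈-∃++; ∈-map⁺; ∈-map⁻; ∈-filter⁺; ∈-filter⁻; ∈-allFin; ∈-lookup)
import Data.List.Membership.DecPropositional as DecMembership
import Data.List.Properties as Listₚ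
open import Data.List.Relation.Binary.Permutation.Propositional using (_↭_; ↭-refl; ↭-reflexive; ↭-trans; ↭⇒↭ₛ; prep; swap)
import Data.List.Relation.Binary.Permutation.Propositional.Properties as Perm
import Data.List.Relation.Binary.Permutation.Setoid.Properties as PermS
open import Data.List.Relation.Unary.All as All using (All; []; _∷_)
import Data.List.Relation.Unary.All.Properties as Allₚ
open import Data.List.Relation.Unary.AllPairs using ([]; _∷_)
open import Data.List.Relation.Unary.Any using (here; there)
open import Data.List.Relation.Unary.Unique.Propositional using (Unique)
import Data.List.Relation.Unary.Unique.Propositional.Properties as Uniqueₚ
open import Data.Maybe using (Maybe; just; nothing)
open import Data.Nat as ℕ using (ℕ; zero; suc; s≤s; z≤n; _≡ᵇ_; _≤ᵇ_) renaming (_+_ to _+ℕ_; _*_ to _*ℕ_; _≤_ to _≤ℕ_; _<_ to _<ℕ_)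
import Data.Nat.Properties as ℕₚ
open import Data.Nat.Tactic.RingSolver using (solve-∀)
open import Data.Product using (Σ; ∃; ∃₂; _×_; _,_; proj₁; proj₂)
import Data.Sign as Sign
open import Data.Sum using (_⊎_; inj₁; inj₂; [_,_]′)
open import Data.Unit.Polymorphic using (⊤; tt)
open import Data.Vec.Functional using (insertAt)
open import Data.Vec.Functional.Properties using (insertAt-lookup; insertAt-punchIn)
open import Function using (_∘_; id)
open import Function.Bundles using (_⇔_; mk⇔)
open import Level using (_⊔_)
open import Relation.Binary.PropositionalEquality as ≡ using (_≡_; _≢_)
import Relation.Binary.Reasoning.Setoid
open import Relation.Nullary using (¬_; Dec; yes; no; does; ¬?; _×-dec_; decidable-stable)
open import Relation.Nullary.Decidable using (dec-true; dec-false)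

-- Ordered fields

-- Counting alone does not isolate the spider. The value 4 of n - 2m would also allow a root of kind
-- P with a Z branch on three vertices, and a root of kind Z with two leaf children and one P child.
-- Both are excluded through μ. A two-vertex leg forces μ² - 3μ + 1 = 0. A three-vertex path of kind
-- Z refutes this equation, because its lower two vertices have a nonzero pivot. A Z vertex of
-- degree 3 with two leaf children, its third neighbour contributing nothing to the pivot, forces μ²
-- - 4μ + 1 = 0, which is incompatible with it. So each excess is carried together with what a small
-- excess says about this equation. A root of kind P with excess 0 fails by parity of n. The field
-- is an arbitrary ordered field and need not contain √5, so the two exceptional values appear only
-- as roots a and 3 - a of one polynomial.

module FieldKit {c ℓ} (F : OrderedField c ℓ) where
  open OrderedField F public
  private
    module R = Algebra.Properties.Ring ring
    module G = Algebra.Properties.AbelianGroup +-abelianGroup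
  open import Relation.Binary.Reasoning.Setoid setoid

  ι-+ : ∀ m n → ι (m +ℕ n) ≈ ι m + ι n
  ι-+ zero    n = sym (+-identityˡ _)
  ι-+ (suc m) n = trans (+-congˡ (ι-+ m n)) (sym (+-assoc _ _ _))

  ι-* : ∀ m n → ι (m *ℕ n) ≈ ι m * ι n
  ι-* zero    n = sym (zeroˡ _)
  ι-* (suc m) n = begin
    ι (n +ℕ m *ℕ n)     ≈⟨ ι-+ n (m *ℕ n) ⟩
    ι n + ι (m *ℕ n)    ≈⟨ +-cong (sym (*-identityˡ _)) (ι-* m n) ⟩
    1# * ι n + ι m * ι n ≈⟨ distribʳ _ _ _ ⟨
    (1# + ι m) * ι n ∎

  private
    ℤ⟦_⟧ : ℤ → Carrier
    ℤ⟦ ℤ.+ n ⟧    = ι n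
    ℤ⟦ -[1+ n ] ⟧ = - ι (suc n)

    cancel₁ : ∀ a b → a - b ≈ (1# + a) - (1# + b)
    cancel₁ a b = begin
      a - b                     ≈⟨ +-identityˡ _ ⟨
      0# + (a - b)              ≈⟨ +-congʳ (-‿inverseʳ 1#) ⟨
      (1# - 1#) + (a - b)       ≈⟨ +-assoc _ _ _ ⟩
      1# + (- 1# + (a - b))     ≈⟨ +-congˡ (+-assoc _ _ _) ⟨
      1# + ((- 1# + a) - b)     ≈⟨ +-congˡ (+-congʳ (+-comm _ _)) ⟩
      1# + ((a - 1#) - b)       ≈⟨ +-congˡ (+-assoc _ _ _) ⟩
      1# + (a + (- 1# - b))     ≈⟨ +-assoc _ _ _ ⟨
      (1# + a) + (- 1# - b)     ≈⟨ +-congˡ (G.⁻¹-∙-comm 1# b) ⟩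
      (1# + a) - (1# + b)       ∎

    ⊖-homo : ∀ m n → ℤ⟦ m ℤ.⊖ n ⟧ ≈ ι m - ι n
    ⊖-homo zero    zero    = sym (-‿inverseʳ 0#)
    ⊖-homo zero    (suc n) = sym (+-identityˡ _)
    ⊖-homo (suc m) zero    = sym (trans (+-congˡ R.-0#≈0#) (+-identityʳ _))
    ⊖-homo (suc m) (suc n) rewrite ℤₚ.[1+m]⊖[1+n]≡m⊖n m n = trans (⊖-homo m n) (cancel₁ _ _)

    ℤ-+-homo : ∀ i j → ℤ⟦ i ℤ.+ j ⟧ ≈ ℤ⟦ i ⟧ + ℤ⟦ j ⟧
    ℤ-+-homo (ℤ.+ m)    (ℤ.+ n)    = ι-+ m n
    ℤ-+-homo (ℤ.+ m)    (-[1+ n ]) = ⊖-homo m (suc n)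
    ℤ-+-homo (-[1+ m ]) (ℤ.+ n)    = trans (⊖-homo n (suc m)) (+-comm _ _)
    ℤ-+-homo (-[1+ m ]) (-[1+ n ]) = begin
      - ι (suc (suc (m +ℕ n)))     ≡⟨ ≡.cong (λ k → - ι (suc k)) (ℕₚ.+-suc m n) ⟨
      - ι (suc m +ℕ suc n)         ≈⟨ -‿cong (ι-+ (suc m) (suc n)) ⟩
      - (ι (suc m) + ι (suc n))    ≈⟨ G.⁻¹-∙-comm _ _ ⟨
      - ι (suc m) - ι (suc n)      ∎

    +◃-homo : ∀ n → ℤ⟦ Sign.+ ℤ.◃ n ⟧ ≈ ι n
    +◃-homo n = reflexive (≡.cong ℤ⟦_⟧ (ℤₚ.+◃n≡+n n))

    -◃-homo : ∀ n → ℤ⟦ Sign.- ℤ.◃ n ⟧ ≈ - ι n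
    -◃-homo zero    = sym R.-0#≈0#
    -◃-homo (suc n) = refl

    ℤ-*-homo : ∀ i j → ℤ⟦ i ℤ.* j ⟧ ≈ ℤ⟦ i ⟧ * ℤ⟦ j ⟧
    ℤ-*-homo (ℤ.+ m)    (ℤ.+ n)    = trans (+◃-homo (m *ℕ n)) (ι-* m n)
    ℤ-*-homo (ℤ.+ m)    (-[1+ n ]) = trans (-◃-homo (m *ℕ suc n)) (trans (-‿cong (ι-* m (suc n))) (R.-‿distribʳ-* _ _))
    ℤ-*-homo (-[1+ m ]) (ℤ.+ n)    = trans (-◃-homo (suc m *ℕ n)) (trans (-‿cong (ι-* (suc m) n)) (R.-‿distribˡ-* _ _))
    ℤ-*-homo (-[1+ m ]) (-[1+ n ]) = trans (+◃-homo (suc m *ℕ suc n)) (begin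
      ι (suc m *ℕ suc n)           ≈⟨ ι-* (suc m) (suc n) ⟩
      ι (suc m) * ι (suc n)        ≈⟨ R.-‿involutive _ ⟨
      - - (ι (suc m) * ι (suc n))  ≈⟨ -‿cong (R.-‿distribʳ-* _ _) ⟩
      - (ι (suc m) * - ι (suc n))  ≈⟨ R.-‿distribˡ-* _ _ ⟩
      - ι (suc m) * - ι (suc n)    ∎)

    ℤ--homo : ∀ i → ℤ⟦ ℤ.- i ⟧ ≈ - ℤ⟦ i ⟧
    ℤ--homo (ℤ.+ zero)  = sym R.-0#≈0#
    ℤ--homo (ℤ.+ suc n) = refl
    ℤ--homo (-[1+ n ])  = sym (R.-‿involutive _)

    ℤ-morphism : ℤ.+-*-rawRing -Raw-AlmostCommutative⟶ fromCommutativeRing commutativeRing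
    ℤ-morphism = record
      { ⟦_⟧    = ℤ⟦_⟧
      ; +-homo = ℤ-+-homo
      ; *-homo = ℤ-*-homo
      ; -‿homo = ℤ--homo
      ; 0-homo = refl
      ; 1-homo = +-identityʳ 1#
      }

    ℤ-weak≟ : ∀ i j → Maybe (ℤ⟦ i ⟧ ≈ ℤ⟦ j ⟧)
    ℤ-weak≟ i j with i ℤ.≟ j
    ... | yes i≡j = just (reflexive (≡.cong ℤ⟦_⟧ i≡j))
    ... | no  _   = nothing

  module Solver = Algebra.Solver.Ring ℤ.+-*-rawRing (fromCommutativeRing commutativeRing) ℤ-morphism ℤ-weak≟
  open Solver public using (solve; _:+_; _:*_; _:-_; :-_; _:=_; con)

  -- Trichotomy decides equality; this is what allows the elimination to branch on whether a pivot
  -- vanishes.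
  _≈?_ : ∀ x y → Dec (x ≈ y)
  x ≈? y with <-trichot x y
  ... | inj₁ x<y        = no λ x≈y → <-irrefl y (<-resp-≈ x≈y refl x<y)
  ... | inj₂ (inj₁ x≈y) = yes x≈y
  ... | inj₂ (inj₂ y<x) = no λ x≈y → <-irrefl y (<-resp-≈ refl x≈y y<x)

  _≉0 : Carrier → Set ℓ
  x ≉0 = ¬ x ≈ 0#

  *-cancel-0 : ∀ {x y} → x ≉0 → x * y ≈ 0# → y ≈ 0#
  *-cancel-0 {x} {y} x≉0 xy≈0 with inverse x x≉0
  ... | z , xz≈1 = begin
    y             ≈⟨ *-identityˡ y ⟨
    1# * y        ≈⟨ *-congʳ xz≈1 ⟨
    (x * z) * y   ≈⟨ solve 3 (λ x y z → (x :* z) :* y := z :* (x :* y)) refl x y z ⟩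
    z * (x * y)   ≈⟨ *-congˡ xy≈0 ⟩
    z * 0#        ≈⟨ zeroʳ z ⟩
    0#            ∎

  x-y≈0⇒x≈y : ∀ {x y} → x - y ≈ 0# → x ≈ y
  x-y≈0⇒x≈y {x} {y} h = begin
    x            ≈⟨ solve 2 (λ x y → x := (x :- y) :+ y) refl x y ⟩
    (x - y) + y  ≈⟨ +-congʳ h ⟩
    0# + y       ≈⟨ +-identityˡ y ⟩
    y            ∎

  x≈y⇒x-y≈0 : ∀ {x y} → x ≈ y → x - y ≈ 0#
  x≈y⇒x-y≈0 {x} {y} h = trans (+-congʳ h) (-‿inverseʳ y)

  -- Uses an equation p ≈ q in a goal a ≈ b, leaving a polynomial identity for the ring solver.
  by-eq : ∀ {a b p q} k → p ≈ q → a ≈ b + k * (p - q) → a ≈ b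
  by-eq k p≈q h = trans h (trans (+-congˡ (trans (*-congˡ (x≈y⇒x-y≈0 p≈q)) (zeroʳ k))) (+-identityʳ _))

  -- The solver reads the constant 1 as `ι 1`, that is `1# + 0#`. Identities that contain `1#`
  -- therefore treat it as a variable, and this equation makes up the difference.
  ι1≈1 : ι 1 ≈ 1#
  ι1≈1 = +-identityʳ 1#

-- Unfolding an acyclic graph into a rooted tree

module RoseTrees where
  open ≡ using (refl; cong; subst)

  data Rose (A : Set) : Set where
    node : A → List (Rose A) → Rose A

  module _ {A : Set} where

    root : Rose A → A
    root (node v _) = v

    verts  : Rose A → List A
    vertsF : List (Rose A) → List A
    verts (node v ts) = v ∷ vertsF ts
    vertsF []         = []
    vertsF (t ∷ ts)   = verts t ++ vertsF ts

    root∈verts : ∀ t → root t ∈ verts t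
    root∈verts (node v ts) = here refl

    vertsF⁺ : ∀ {t ts v} → t ∈ ts → v ∈ verts t → v ∈ vertsF ts
    vertsF⁺ (here refl) v∈ = ∈-++⁺ˡ v∈
    vertsF⁺ {ts = t ∷ _} (there t∈) v∈ = ∈-++⁺ʳ (verts t) (vertsF⁺ t∈ v∈)

    vertsF⁻ : ∀ ts {v} → v ∈ vertsF ts → ∃ λ t → t ∈ ts × v ∈ verts t
    vertsF⁻ (t ∷ ts) v∈ with ∈-++⁻ (verts t) v∈
    ... | inj₁ v∈t = t , here refl , v∈t
    ... | inj₂ v∈ts with vertsF⁻ ts v∈ts
    ...   | u , u∈ , v∈u = u , there u∈ , v∈u

    All≢⇒∉ : ∀ {v : A} {l} → All (v ≢_) l → v ∉ l
    All≢⇒∉ = Allₚ.All¬⇒¬Any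

    ∉⇒All≢ : ∀ {v : A} {l} → v ∉ l → All (v ≢_) l
    ∉⇒All≢ = Allₚ.¬Any⇒All¬ _

    Unique-++⁻ˡ : ∀ (xs : List A) {ys} → Unique (xs ++ ys) → Unique xs
    Unique-++⁻ˡ []       _        = []
    Unique-++⁻ˡ (x ∷ xs) (p ∷ ps) = Allₚ.++⁻ˡ xs p ∷ Unique-++⁻ˡ xs ps

    Unique-middle : ∀ (xs : List A) {v ys} → Unique (xs ++ v ∷ ys) → v ∉ xs
    Unique-middle (x ∷ xs) (p ∷ ps) (here refl) = All≢⇒∉ p (∈-++⁺ʳ xs (here refl))
    Unique-middle (x ∷ xs) (p ∷ ps) (there v∈)  = Unique-middle xs ps v∈

    lookup-injective : ∀ {l : List A} → Unique l → ∀ {i j} → lookup l i ≡ lookup l j → i ≡ j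
    lookup-injective (p ∷ ps) {fzero}  {fzero}  _  = refl
    lookup-injective {_ ∷ l} (p ∷ ps) {fzero} {fsuc j} eq = ⊥-elim (All≢⇒∉ p (subst (_∈ l) (≡.sym eq) (∈-lookup j)))
    lookup-injective {_ ∷ l} (p ∷ ps) {fsuc i} {fzero} eq = ⊥-elim (All≢⇒∉ p (subst (_∈ l) eq (∈-lookup i)))
    lookup-injective (p ∷ ps) {fsuc i} {fsuc j} eq = cong fsuc (lookup-injective ps eq)

    Unique-⊆⇒length≤ : ∀ {xs ys : List A} → Unique xs → (∀ {v} → v ∈ xs → v ∈ ys) → length xs ≤ℕ length ys
    Unique-⊆⇒length≤ [] _ = z≤n
    Unique-⊆⇒length≤ {x ∷ xs} (p ∷ ps) sub with ∈-∃++ (sub (here refl))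
    ... | as , bs , refl = subst (suc (length xs) ≤ℕ_) len (s≤s (Unique-⊆⇒length≤ ps sub′))
      where
      sub′ : ∀ {v} → v ∈ xs → v ∈ as ++ bs
      sub′ v∈ with ∈-++⁻ as (sub (there v∈))
      ... | inj₁ q           = ∈-++⁺ˡ q
      ... | inj₂ (here refl) = ⊥-elim (All≢⇒∉ p v∈)
      ... | inj₂ (there q)   = ∈-++⁺ʳ as q
      len : suc (length (as ++ bs)) ≡ length (as ++ x ∷ bs)
      len rewrite Listₚ.length-++ as {bs} | Listₚ.length-++ as {x ∷ bs} = ≡.sym (ℕₚ.+-suc (length as) (length bs))

  module _ {n : ℕ} (G : Graph n) where

    open DecMembership (Fin._≟_ {n}) using (_∈?_)

    private
      V : Set
      V = Fin n

    _~_ : V → V → Set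
    u ~ v = adj G u v ≡ true

    ~-sym : ∀ {u v} → u ~ v → v ~ u
    ~-sym {u} {v} u~v = ≡.trans (Graph.sym G v u) u~v

    ~-irrefl : ∀ {u} → ¬ u ~ u
    ~-irrefl {u} u~u with ≡.trans (≡.sym u~u) (irrefl G u)
    ... | ()

    -- Walks v ∷ l without immediate backtracking.
    data NB : V → List V → Set where
      []   : ∀ {v} → NB v []
      step : ∀ {v w l} → v ~ w → v ∉ take 1 l → NB w l → NB v (w ∷ l)

    private
      consecutive : ∀ {w} as {v bs} → NB w (as ++ v ∷ bs) →
        (∀ (i : Fin (length as)) → lookup (w ∷ as) (inject₁ i) ~ lookup (w ∷ as) (fsuc i)) ×
        lookup (w ∷ as) (fromℕ (length as)) ~ v
      consecutive []       (step w~v _ _) = (λ ()) , w~v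
      consecutive {w} (a ∷ as) {v} {bs} (step w~a _ nb) with consecutive as nb
      ... | inner , last = inner′ , last
        where
        inner′ : ∀ (i : Fin (length (a ∷ as))) → lookup (w ∷ a ∷ as) (inject₁ i) ~ lookup (w ∷ a ∷ as) (fsuc i)
        inner′ fzero    = w~a
        inner′ (fsuc i) = inner i

    module _ (acyclic : Acyclic G) where

      -- By induction the walk after `v` has no repetition. If it came back to `v`, its part up to
      -- that return would be a cycle; the return is not immediate, so the cycle has at least three
      -- vertices.
      NB⇒Unique : ∀ {v l} → NB v l → Unique (v ∷ l)
      NB⇒Unique [] = [] ∷ []
      NB⇒Unique {v} {w ∷ l} (step v~w v∉ nb) = ∉⇒All≢ fresh ∷ NB⇒Unique nb
        where
        fresh : v ∉ w ∷ l
        fresh (here refl) = ~-irrefl v~w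
        fresh (there v∈l) with ∈-∃++ v∈l
        ... | [] , bs , refl = v∉ (here refl)
        ... | z ∷ as , bs , refl = acyclic (length as) (lookup C) (lookup-injective C! , inner , proj₂ (consecutive (z ∷ as) nb))
          where
          C = v ∷ w ∷ z ∷ as
          wza! : Unique (w ∷ z ∷ as ++ v ∷ bs)
          wza! = NB⇒Unique nb
          C! : Unique C
          C! = ∉⇒All≢ (Unique-middle (w ∷ z ∷ as) wza!) ∷ Unique-++⁻ˡ (w ∷ z ∷ as) wza!
          inner : ∀ (i : Fin (suc (suc (length as)))) → lookup C (inject₁ i) ~ lookup C (fsuc i)
          inner fzero    = v~w
          inner (fsuc i) = proj₁ (consecutive (z ∷ as) nb) i

    -- Rep us t: t is the unfolding of G from its root, where us (empty or a singleton) holds the parent of the root.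
    data Rep (us : List V) : Rose V → Set where
      node : ∀ {v ts} → Unique us → All (v ~_) us → Unique (map root ts) → All (λ t → v ~ root t × root t ∉ us) ts →
             (∀ j → v ~ j → j ∈ us ++ map root ts) → All (Rep (v ∷ [])) ts → Rep us (node v ts)

    private
      child? : ∀ us v w → Dec (v ~ w × w ∉ us)
      child? us v w = (adj G v w Bool.≟ true) ×-dec ¬? (w ∈? us)

      kids : List V → V → List V
      kids us v = filter (child? us v) (allFin n)

      take1-unique : ∀ (l : List V) → Unique (take 1 l)
      take1-unique []      = []
      take1-unique (_ ∷ _) = [] ∷ []

      take1-adj : ∀ {v l} → NB v l → All (v ~_) (take 1 l)
      take1-adj []              = []
      take1-adj (step v~w _ _) = v~w ∷ []

    module _ (acyclic : Acyclic G) where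

      NB-length : ∀ {v l} → NB v l → suc (length l) ≤ℕ n
      NB-length {v} {l} nb = subst (suc (length l) ≤ℕ_) (Listₚ.length-tabulate {n = n} id)
        (Unique-⊆⇒length≤ (NB⇒Unique acyclic nb) (λ _ → ∈-allFin _))

      private
        -- The index `l` is the walk from `v` back to the starting vertex, with the parent of `v` in
        -- front. It never repeats a vertex, so `k` bounds the remaining depth and cannot reach 0.
        unfold′ : ∀ k {v l} → NB v l → n ≤ℕ length l +ℕ k → Σ (Rose V) λ t → root t ≡ v × Rep (take 1 l) t
        unfoldF : ∀ k {v l} → NB v l → n ≤ℕ suc (length l +ℕ k) → ∀ ws → All (λ w → v ~ w × w ∉ take 1 l) ws →
                  Σ (List (Rose V)) λ ts → map root ts ≡ ws × All (Rep (v ∷ [])) ts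
        unfold′ zero {v} {l} nb fuel = ⊥-elim (ℕₚ.<⇒≱ (NB-length nb) (subst (n ≤ℕ_) (ℕₚ.+-identityʳ _) fuel))
        unfold′ (suc k) {v} {l} nb fuel
          with unfoldF k nb (subst (n ≤ℕ_) (ℕₚ.+-suc _ k) fuel) (kids us v) (All.tabulate (proj₂ ∘ ∈-filter⁻ (child? us v) {xs = allFin n}))
          where us = take 1 l
        ... | ts , roots , reps = node v ts , refl , node (take1-unique l) (take1-adj nb)
                (subst Unique (≡.sym roots) (Uniqueₚ.filter⁺ (child? us v) (Uniqueₚ.allFin⁺ n)))
                (All.tabulate λ t∈ → proj₂ (∈-filter⁻ (child? us v) {xs = allFin n} (subst (_ ∈_) roots (∈-map⁺ root t∈))))
                complete reps
          where
          us = take 1 l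
          complete : ∀ j → v ~ j → j ∈ us ++ map root ts
          complete j v~j with j ∈? us
          ... | yes j∈ = ∈-++⁺ˡ j∈
          ... | no  j∉ = ∈-++⁺ʳ us (subst (j ∈_) (≡.sym roots) (∈-filter⁺ (child? us v) (∈-allFin j) (v~j , j∉)))
        unfoldF k nb fuel [] [] = [] , refl , []
        unfoldF k nb fuel (w ∷ ws) ((v~w , w∉) ∷ ps)
          with unfold′ k (step (~-sym v~w) w∉ nb) fuel | unfoldF k nb fuel ws ps
        ... | t , refl , rep | ts , refl , reps = t ∷ ts , refl , rep ∷ reps

      unfold : ∀ r → Σ (Rose V) λ t → root t ≡ r × Rep [] t
      unfold r = unfold′ n [] ℕₚ.≤-refl

      private
        -- A walk out of the root of a branch is prolonged backwards so that it starts at a given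
        -- vertex `w` of the branch. Recording that the old vertices survive is what later exposes a
        -- repetition.
        down : ∀ {l t w} → Rep (take 1 l) t → NB (root t) l → w ∈ verts t →
               Σ (List V) λ l′ → NB w l′ × (∀ {a} → a ∈ l → a ∈ l′)
        downF : ∀ {v l ts w} → All (Rep (v ∷ [])) ts → All (λ t → v ~ root t × root t ∉ take 1 l) ts → NB v l → w ∈ vertsF ts →
                Σ (List V) λ l′ → NB w l′ × (∀ {a} → a ∈ v ∷ l → a ∈ l′)
        down {l} (node _ _ _ _ _ _) nb (here refl) = l , nb , id
        down (node _ _ _ kid _ reps) nb (there w∈) with downF reps kid nb w∈
        ... | l′ , nb′ , sub = l′ , nb′ , sub ∘ there
        downF {ts = t ∷ ts} (rep ∷ reps) ((v~ , ∉us) ∷ ks) nb w∈ with ∈-++⁻ (verts t) w∈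
        ... | inj₁ w∈t  = down rep (step (~-sym v~) ∉us nb) w∈t
        ... | inj₂ w∈ts = downF reps ks nb w∈ts

        -- The opposite direction: a walk from the root of a branch to `w` that does not begin by
        -- stepping to the parent, so that it may follow a step from the parent without
        -- backtracking.
        up : ∀ {us t w} → Rep us t → w ∈ verts t →
             Σ (List V) λ l → NB (root t) l × (∀ {u} → u ∈ us → u ∉ take 1 l) × w ∈ root t ∷ l
        upF : ∀ {v us ts w} → All (Rep (v ∷ [])) ts → All (λ t → v ~ root t × root t ∉ us) ts → w ∈ vertsF ts →
             Σ (List V) λ l → NB v l × (∀ {u} → u ∈ us → u ∉ take 1 l) × w ∈ l
        up (node _ _ _ _ _ _) (here refl) = [] , [] , (λ _ ()) , here refl
        up (node _ _ _ kid _ reps) (there w∈) with upF reps kid w∈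
        ... | l , nb , dis , w∈l = l , nb , dis , there w∈l
        upF {ts = t ∷ ts} (rep ∷ reps) ((v~ , ∉us) ∷ ks) w∈ with ∈-++⁻ (verts t) w∈
        ... | inj₂ w∈ts = upF reps ks w∈ts
        ... | inj₁ w∈t with up rep w∈t
        ...   | l , nb , dis , w∈l = root t ∷ l , step v~ (dis (here refl)) nb , (λ { u∈ (here refl) → ∉us u∈ }) , w∈l

      -- A vertex occurring twice would lie on a non-backtracking walk from itself to itself: climb
      -- from one occurrence to the common ancestor, then descend to the other.
      verts-unique : ∀ {us t} → Rep us t → Unique (verts t)
      private
        vertsF-unique : ∀ {v ts} → All (Rep (v ∷ [])) ts → All (λ t → v ~ root t) ts → Unique (map root ts) → Unique (vertsF ts)
      verts-unique {us} {node v ts} (node _ _ kids! kid _ reps) =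
        ∉⇒All≢ v∉ ∷ vertsF-unique reps (All.map proj₁ kid) kids!
        where
        v∉ : v ∉ vertsF ts
        v∉ v∈ with downF {l = []} reps (All.map (λ (p , _) → p , λ ()) kid) [] v∈
        ... | l′ , nb′ , sub = Uniqueₚ.Unique[x∷xs]⇒x∉xs (NB⇒Unique acyclic nb′) (sub (here refl))
      vertsF-unique [] [] [] = []
      vertsF-unique {v} {t ∷ ts} (rep ∷ reps) (v~t ∷ v~ts) (t∉ ∷ ts!) =
        Uniqueₚ.++⁺ (verts-unique rep) (vertsF-unique reps v~ts ts!) disjoint
        where
        disjoint : ∀ {w} → ¬ (w ∈ verts t × w ∈ vertsF ts)
        disjoint (w∈t , w∈ts) with up rep w∈t
        ... | l , nb , dis , w∈l
          with downF {l = root t ∷ l} reps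
                 (All.tabulate λ {s} s∈ → All.lookup v~ts s∈ , λ { (here eq) → All≢⇒∉ t∉ (subst (_∈ map root ts) eq (∈-map⁺ root s∈)) })
                 (step v~t (dis (here refl)) nb) w∈ts
        ...   | l′ , nb′ , sub = Uniqueₚ.Unique[x∷xs]⇒x∉xs (NB⇒Unique acyclic nb′) (sub (there w∈l))

    private
      closed : ∀ {us t v j} → Rep us t → v ∈ verts t → v ~ j → j ∈ us ⊎ j ∈ verts t
      closedF : ∀ {u ts v j} → All (Rep (u ∷ [])) ts → v ∈ vertsF ts → v ~ j → j ≡ u ⊎ j ∈ vertsF ts
      closed {us} {node v ts} {j = j} (node _ _ _ _ complete _) (here refl) v~j with ∈-++⁻ us (complete j v~j)
      ... | inj₁ j∈ = inj₁ j∈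
      ... | inj₂ j∈ with ∈-map⁻ root j∈
      ...   | t , t∈ , refl = inj₂ (there (vertsF⁺ t∈ (root∈verts t)))
      closed (node _ _ _ _ _ reps) (there v∈) v~j with closedF reps v∈ v~j
      ... | inj₁ refl = inj₂ (here refl)
      ... | inj₂ j∈   = inj₂ (there j∈)
      closedF {ts = t ∷ ts} (rep ∷ reps) v∈ v~j with ∈-++⁻ (verts t) v∈
      ... | inj₂ v∈ts with closedF reps v∈ts v~j
      ...   | inj₁ eq = inj₁ eq
      ...   | inj₂ j∈ = inj₂ (∈-++⁺ʳ (verts t) j∈)
      closedF {ts = t ∷ ts} (rep ∷ reps) v∈ v~j | inj₁ v∈t with closed rep v∈t v~j
      ...   | inj₁ (here refl) = inj₁ refl
      ...   | inj₂ j∈ = inj₂ (∈-++⁺ˡ j∈)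

      walk-closed : ∀ {t i j} → Rep [] t → i ∈ verts t → Walk G i j → j ∈ verts t
      walk-closed rep i∈ here = i∈
      walk-closed rep i∈ (step e w) with closed rep i∈ e
      ... | inj₂ j∈ = walk-closed rep j∈ w

    covers : Connected G → ∀ {t} → Rep [] t → ∀ j → j ∈ verts t
    covers conn {t} rep j = walk-closed rep (root∈verts t) (conn (root t) j)

    verts-length : IsTree G → ∀ {t} → Rep [] t → length (verts t) ≡ n
    verts-length (conn , acyc) {t} rep = ℕₚ.≤-antisym
      (subst (length (verts t) ≤ℕ_) len (Unique-⊆⇒length≤ (verts-unique acyc rep) (λ _ → ∈-allFin _)))
      (subst (_≤ℕ length (verts t)) len (Unique-⊆⇒length≤ (Uniqueₚ.allFin⁺ n) (λ {v} _ → covers conn rep v)))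
      where
      len : length (allFin n) ≡ n
      len = Listₚ.length-tabulate {n = n} id

open RoseTrees

-- Independent families and forcing sets

module LinAlg {c ℓ} (F : OrderedField c ℓ) where
  open FieldKit F
  open import Relation.Binary.Reasoning.Setoid setoid

  ∑-cong : ∀ {k} {f g : Fin k → Carrier} → (∀ i → f i ≈ g i) → ∑ f ≈ ∑ g
  ∑-cong {zero}  h = refl
  ∑-cong {suc k} h = +-cong (h fzero) (∑-cong (h ∘ fsuc))

  ∑-zero : ∀ {k} {f : Fin k → Carrier} → (∀ i → f i ≈ 0#) → ∑ f ≈ 0#
  ∑-zero {zero}  h = refl
  ∑-zero {suc k} h = trans (+-cong (h fzero) (∑-zero (h ∘ fsuc))) (+-identityˡ 0#)

  ∑-linear : ∀ {k} a (f g : Fin k → Carrier) → ∑ (λ i → f i + a * g i) ≈ ∑ f + a * ∑ g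
  ∑-linear {zero}  a f g = solve 1 (λ a → con (ℤ.+ 0) := con (ℤ.+ 0) :+ a :* con (ℤ.+ 0)) refl a
  ∑-linear {suc k} a f g = trans (+-congˡ (∑-linear a (f ∘ fsuc) (g ∘ fsuc)))
    (solve 5 (λ a x y z w → (x :+ a :* y) :+ (z :+ a :* w) := (x :+ z) :+ a :* (y :+ w)) refl a (f fzero) (g fzero) _ _)

  ∑-punchIn : ∀ {k} (p : Fin (suc k)) (f : Fin (suc k) → Carrier) → ∑ f ≈ f p + ∑ (f ∘ punchIn p)
  ∑-punchIn fzero f = refl
  ∑-punchIn {suc k} (fsuc p) f = trans (+-congˡ (∑-punchIn p (f ∘ fsuc)))
    (solve 3 (λ x y z → x :+ (y :+ z) := y :+ (x :+ z)) refl (f fzero) (f (fsuc p)) _)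

  ∑-split : ∀ {k} (u : Fin k) {f g : Fin k → Carrier} → (∀ j → j ≢ u → f j ≈ g j) → g u ≈ 0# → ∑ f ≈ f u + ∑ g
  ∑-split fzero {f} {g} same gu≈0 = +-congˡ (trans (∑-cong λ i → same (fsuc i) λ ())
    (trans (sym (+-identityˡ _)) (+-congʳ (sym gu≈0))))
  ∑-split (fsuc u) {f} {g} same gu≈0 = trans
    (+-cong (same fzero λ ()) (∑-split u (λ j j≢u → same (fsuc j) (j≢u ∘ Finₚ.suc-injective)) gu≈0))
    (solve 3 (λ x y z → x :+ (y :+ z) := y :+ (x :+ z)) refl (g fzero) (f (fsuc u)) _)

  sumOver : ∀ {A : Set} → (A → Carrier) → List A → Carrier
  sumOver f []      = 0#
  sumOver f (v ∷ l) = f v + sumOver f l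

  sumOver-1 : ∀ {A : Set} (l : List A) → sumOver (λ _ → 1#) l ≡ ι (length l)
  sumOver-1 []      = ≡.refl
  sumOver-1 (_ ∷ l) = ≡.cong (1# +_) (sumOver-1 l)

  private
    ind : Bool → Carrier → Carrier
    ind b x = if b then x else 0#

  ∑-indicator : ∀ {n} (f : Fin n → Carrier) (g : Fin n → Bool) {l} → Unique l →
    (∀ j → g j ≡ true → j ∈ l) → (∀ {j} → j ∈ l → g j ≡ true) →
    ∑ (λ j → if g j then f j else 0#) ≈ sumOver f l
  ∑-indicator f g {[]} [] to from = ∑-zero zeros
    where
    zeros : ∀ j → ind (g j) (f j) ≈ 0#
    zeros j with g j in eq
    ... | false = refl
    ... | true with () ← to j eq
  ∑-indicator {n} f g {u ∷ l} (u∉ ∷ l!) to from = begin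
    ∑ (λ j → ind (g j) (f j))                   ≈⟨ ∑-split u same atu ⟩
    ind (g u) (f u) + ∑ (λ j → ind (g′ j) (f j)) ≡⟨ ≡.cong (λ b → ind b (f u) + ∑ (λ j → ind (g′ j) (f j))) (from (here ≡.refl)) ⟩
    f u + ∑ (λ j → ind (g′ j) (f j))            ≈⟨ +-congˡ (∑-indicator f g′ l! to′ from′) ⟩
    f u + sumOver f l                           ∎
    where
    g′ : Fin n → Bool
    g′ j with j Fin.≟ u
    ... | yes _ = false
    ... | no  _ = g j
    same : ∀ j → j ≢ u → ind (g j) (f j) ≈ ind (g′ j) (f j)
    same j j≢u with j Fin.≟ u
    ... | yes j≡u = ⊥-elim (j≢u j≡u)
    ... | no  _   = refl
    atu : ind (g′ u) (f u) ≈ 0#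
    atu with u Fin.≟ u
    ... | yes _   = refl
    ... | no  u≢u = ⊥-elim (u≢u ≡.refl)
    to′ : ∀ j → g′ j ≡ true → j ∈ l
    to′ j gj with j Fin.≟ u
    to′ j () | yes _
    to′ j gj | no j≢u with to j gj
    ... | here j≡u = ⊥-elim (j≢u j≡u)
    ... | there j∈ = j∈
    from′ : ∀ {j} → j ∈ l → g′ j ≡ true
    from′ {j} j∈ with j Fin.≟ u
    ... | yes ≡.refl = ⊥-elim (All≢⇒∉ u∉ j∈)
    ... | no  _      = from (there j∈)

  ι-countℕ : ∀ {k} (g : Fin k → Bool) → ι (countℕ g) ≈ ∑ (λ j → if g j then 1# else 0#)
  ι-countℕ {zero}  g = refl
  ι-countℕ {suc k} g with g fzero
  ... | true  = +-congˡ (ι-countℕ (g ∘ fsuc))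
  ... | false = trans (ι-countℕ (g ∘ fsuc)) (sym (+-identityˡ _))

  module _ {n} (G : Graph n) where

    laplacian-local : ∀ x v {l} → Unique l → (∀ j → adj G v j ≡ true → j ∈ l) → (∀ {j} → j ∈ l → adj G v j ≡ true) →
      laplacianApply F G x v ≈ ι (length l) * x v - sumOver x l
    laplacian-local x v {l} l! to from = +-cong
      (*-congʳ (trans (ι-countℕ (adj G v)) (trans (∑-indicator (λ _ → 1#) (adj G v) l! to from) (reflexive (sumOver-1 l)))))
      (-‿cong (∑-indicator x (adj G v) l! to from))

    laplacian-linear : ∀ a x y v → laplacianApply F G (λ j → x j + a * y j) v ≈ laplacianApply F G x v + a * laplacianApply F G y v
    laplacian-linear a x y v = trans (+-congˡ (-‿cong (trans (∑-cong pointwise) (∑-linear a (λ j → if adj G v j then x j else 0#) (λ j → if adj G v j then y j else 0#)))))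
      (solve 6 (λ d a x y s t → d :* (x :+ a :* y) :- (s :+ a :* t) := (d :* x :- s) :+ a :* (d :* y :- t)) refl
        (ι (degree G v)) a (x v) (y v) _ _)
      where
      pointwise : ∀ j → (if adj G v j then x j + a * y j else 0#) ≈
                        (if adj G v j then x j else 0#) + a * (if adj G v j then y j else 0#)
      pointwise j with adj G v j
      ... | true  = refl
      ... | false = sym (trans (+-congˡ (zeroʳ a)) (+-identityˡ 0#))

    eigenvector-linear : ∀ {μ} a {x y} → IsLapEigenvector F G μ x → IsLapEigenvector F G μ y →
      IsLapEigenvector F G μ (λ j → x j + a * y j)
    eigenvector-linear {μ} a {x} {y} hx hy v = trans (laplacian-linear a x y v) (trans (+-cong (hx v) (*-congˡ (hy v)))
      (solve 4 (λ μ a x y → μ :* x :+ a :* (μ :* y) := μ :* (x :+ a :* y)) refl μ a (x v) (y v)))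

  -- `W` is an arbitrary predicate so that the eigenspace can be cut down by one condition
  -- `x v ≈ 0#` at a time.
  record Indep {p} {n} (W : (Fin n → Carrier) → Set p) (k : ℕ) : Set (c ⊔ ℓ ⊔ p) where
    constructor indep
    field
      vectors     : Fin k → Fin n → Carrier
      inside      : ∀ t → W (vectors t)
      independent : LinIndep F vectors

  Indep-pred : ∀ {p n k} {W : (Fin n → Carrier) → Set p} → Indep W (suc k) → Indep W k
  Indep-pred {k = k} (indep vs inW ind) = indep (vs ∘ fsuc) (inW ∘ fsuc) λ a h i →
    ind (extend a) (λ j → trans (+-cong (zeroˡ (vs fzero j)) (h j)) (+-identityˡ 0#)) (fsuc i)
    where
    extend : (Fin k → Carrier) → Fin (suc k) → Carrier
    extend a fzero    = 0#
    extend a (fsuc i) = a i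

  Indep-≤ : ∀ {p n k m} {W : (Fin n → Carrier) → Set p} → k ≤ℕ m → Indep W m → Indep W k
  Indep-≤ {k = k} k≤m is with ℕₚ.m≤n⇒∃[o]m+o≡n k≤m
  ... | d , ≡.refl = go d is
    where
    go : ∀ d → Indep _ (k +ℕ d) → Indep _ k
    go zero    is = ≡.subst (Indep _) (ℕₚ.+-identityʳ k) is
    go (suc d) is = go d (Indep-pred (≡.subst (Indep _) (ℕₚ.+-suc k d) is))

  Closed : ∀ {p n} → ((Fin n → Carrier) → Set p) → Set (c ⊔ p)
  Closed W = ∀ a {x y} → W x → W y → W (λ j → x j + a * y j)

  -- One step of Gaussian elimination. A vector that is nonzero at `v` serves as pivot and clears
  -- the coordinate `v` of all the others; if there is none, any vector may be dropped.
  Indep-cut : ∀ {p n k} {W : (Fin n → Carrier) → Set p} → Closed W → (v : Fin n) →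
    Indep W (suc k) → Indep (λ x → W x × x v ≈ 0#) k
  Indep-cut {n = n} {k} {W} closed v is@(indep vs inW ind) with Finₚ.any? (λ i → ¬? (vs i v ≈? 0#))
  ... | no ∄p = indep (vs ∘ fsuc)
          (λ t → inW (fsuc t) , decidable-stable (vs (fsuc t) v ≈? 0#) (λ ≉ → ∄p (fsuc t , ≉))) (Indep.independent (Indep-pred is))
  ... | yes (p , pivot) with inverse (vs p v) pivot
  ...   | r , inv = indep us inU indU
    where
    ρ : Fin k → Carrier
    ρ i = - (vs (punchIn p i) v * r)
    us : Fin k → Fin n → Carrier
    us i j = vs (punchIn p i) j + ρ i * vs p j
    inU : ∀ t → W (us t) × us t v ≈ 0#
    inU t = closed (ρ t) (inW _) (inW p) ,
      by-eq (- vs (punchIn p t) v) (trans inv (sym ι1≈1)) (solve 3 (λ x r y →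
        x :+ (:- (x :* r)) :* y := con (ℤ.+ 0) :+ (:- x) :* (y :* r :- con (ℤ.+ 1))) refl (vs (punchIn p t) v) r (vs p v))
    indU : LinIndep F us
    indU a h i = trans (reflexive (≡.sym (insertAt-punchIn a p b i))) (ind (insertAt a p b) comb (punchIn p i))
      where
      -- A relation among the cleared vectors becomes one among the original vectors when the pivot
      -- vector receives this coefficient.
      b : Carrier
      b = ∑ (λ i → ρ i * a i)
      comb : ∀ j → ∑ (λ i → insertAt a p b i * vs i j) ≈ 0#
      comb j = begin
        ∑ (λ i → insertAt a p b i * vs i j)  ≈⟨ ∑-punchIn p (λ i → insertAt a p b i * vs i j) ⟩
        insertAt a p b p * vs p j + ∑ (λ i → insertAt a p b (punchIn p i) * vs (punchIn p i) j)
          ≈⟨ +-cong (*-congʳ (reflexive (insertAt-lookup a p b))) (∑-cong λ i → *-congʳ (reflexive (insertAt-punchIn a p b i))) ⟩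
        b * vs p j + ∑ (λ i → a i * vs (punchIn p i) j)  ≈⟨ trans (+-comm _ _) (+-congˡ (*-comm _ _)) ⟩
        ∑ (λ i → a i * vs (punchIn p i) j) + vs p j * b  ≈⟨ ∑-linear (vs p j) (λ i → a i * vs (punchIn p i) j) (λ i → ρ i * a i) ⟨
        ∑ (λ i → a i * vs (punchIn p i) j + vs p j * (ρ i * a i))
          ≈⟨ ∑-cong (λ i → solve 4 (λ a x y ρ → a :* x :+ y :* (ρ :* a) := a :* (x :+ ρ :* y)) refl (a i) (vs (punchIn p i) j) (vs p j) (ρ i)) ⟩
        ∑ (λ i → a i * us i j)  ≈⟨ h j ⟩
        0# ∎

  Forces : ∀ {p n} → ((Fin n → Carrier) → Set p) → List (Fin n) → Set (c ⊔ ℓ ⊔ p)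
  Forces W S = ∀ {x} → W x → All (λ v → x v ≈ 0#) S → ∀ j → x j ≈ 0#

  -- Each vertex of `S` costs at most one dimension, and once all of them are fixed to 0 only the
  -- zero vector is left, which belongs to no independent family.
  Indep-bound : ∀ {p n k} {W : (Fin n → Carrier) → Set p} → Closed W → ∀ {S} → Forces W S → Indep W k → k ≤ℕ length S
  Indep-bound {k = zero} _ _ _ = z≤n
  Indep-bound {k = suc k} closed {[]} forces (indep vs inW ind) =
    ⊥-elim (0≉1 (sym (ind (λ _ → 1#) (λ j → ∑-zero λ i → trans (*-congˡ (forces (inW i) [] j)) (zeroʳ 1#)) fzero)))
  Indep-bound {k = suc k} closed {v ∷ S} forces is =
    s≤s (Indep-bound (λ a (hx , xv) (hy , yv) → closed a hx hy , trans (+-cong xv (trans (*-congˡ yv) (zeroʳ a))) (+-identityˡ 0#))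
      (λ (wx , xv) zs → forces wx (xv ∷ zs)) (Indep-cut closed v is))

  module _ {n} (G : Graph n) (μ : Carrier) where

    multiplicity≤ : ∀ {m} → HasIndepEigenvectors F G μ m → ∀ {S} → Forces (IsLapEigenvector F G μ) S → m ≤ℕ length S
    multiplicity≤ (vs , eig , ind) forces = Indep-bound (eigenvector-linear G) forces (indep vs eig ind)

    multiplicity≥ : ∀ {m} → LapMultiplicity F G μ m → ∀ {k} → HasIndepEigenvectors F G μ k → k ≤ℕ m
    multiplicity≥ {m} (_ , ¬suc) {k} (vs , eig , ind) with k ℕ.≤? m
    ... | yes k≤m = k≤m
    ... | no  k≰m with Indep-≤ (ℕₚ.≰⇒> k≰m) (indep {W = IsLapEigenvector F G μ} vs eig ind)
    ...   | indep us eigU indU = ⊥-elim (¬suc (us , eigU , indU))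

-- Elimination along a rooted tree

module _ {A : Set} where

  data Leaf : Rose A → Set where
    leaf : ∀ {v} → Leaf (node v [])

  data Leg : Rose A → Set where
    leg : ∀ {z w} → Leg (node z (node w [] ∷ []))

  data LegsLeaf : List (Rose A) → Set where
    here  : ∀ {t ts} → Leaf t → All Leg ts → LegsLeaf (t ∷ ts)
    there : ∀ {t ts} → Leg t → LegsLeaf ts → LegsLeaf (t ∷ ts)

  length-++-combine : ∀ (xs : List A) {ys} (S : List A) {S′} {p p′ r} →
    length xs ≡ 2 *ℕ length S +ℕ p → length ys ≡ 2 *ℕ length S′ +ℕ p′ → p +ℕ p′ ≡ r →
    length (xs ++ ys) ≡ 2 *ℕ length (S ++ S′) +ℕ r
  length-++-combine xs {ys} S {S′} {p} {p′} hx hy ≡.refl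
    rewrite Listₚ.length-++ xs {ys} | Listₚ.length-++ S {S′} | hx | hy = arith (length S) (length S′) p p′
    where
    arith : ∀ s s′ p p′ → (2 *ℕ s +ℕ p) +ℕ (2 *ℕ s′ +ℕ p′) ≡ 2 *ℕ (s +ℕ s′) +ℕ (p +ℕ p′)
    arith = solve-∀

+≡0 : ∀ m {n} → m +ℕ n ≡ 0 → m ≡ 0 × n ≡ 0
+≡0 zero h = ≡.refl , h

+≡1 : ∀ m {n} → m +ℕ n ≡ 1 → (m ≡ 0 × n ≡ 1) ⊎ (m ≡ 1 × n ≡ 0)
+≡1 zero    h = inj₁ (≡.refl , h)
+≡1 (suc m) h with ≡.refl , n≡0 ← +≡0 m (ℕₚ.suc-injective h) = inj₂ (≡.refl , n≡0)

+≡2 : ∀ m {n} → m +ℕ n ≡ 2 → (m ≡ 0 × n ≡ 2) ⊎ ((m ≡ 1 × n ≡ 1) ⊎ (m ≡ 2 × n ≡ 0))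
+≡2 zero    h = inj₁ (≡.refl , h)
+≡2 (suc m) h with +≡1 m (ℕₚ.suc-injective h)
... | inj₁ (≡.refl , n≡1) = inj₂ (inj₁ (≡.refl , n≡1))
... | inj₂ (≡.refl , n≡0) = inj₂ (inj₂ (≡.refl , n≡0))

length≡0 : ∀ {a} {A : Set a} (l : List A) → length l ≡ 0 → l ≡ []
length≡0 [] _ = ≡.refl

small-excess : ∀ {p} {P : Set p} {k e e′} → P ⊎ k ≤ℕ e → e ≡ e′ → e′ ℕ.< k → P
small-excess (inj₁ h) _ _ = h
small-excess (inj₂ k≤e) ≡.refl e<k = ⊥-elim (ℕₚ.<⇒≱ e<k k≤e)

module Elimination {c ℓ} (F : OrderedField c ℓ) (μ : OrderedField.Carrier F)
  (μ≉1 : ¬ (OrderedField._≈_ F μ (OrderedField.1# F))) {A : Set} where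
  open FieldKit F
  open LinAlg F
  open import Relation.Binary.Reasoning.Setoid setoid

  -- A vertex whose only child is a leaf has pivot (2 - μ) - 1/(1 - μ); multiplied by 1 - μ this is
  -- the polynomial here, with roots (3 ± √5)/2.
  Q : Set ℓ
  Q = (μ * μ - ι 3 * μ) + 1# ≈ 0#

  δ : Carrier
  δ = 1# - μ

  δ≉0 : δ ≉0
  δ≉0 δ≈0 = μ≉1 (sym (x-y≈0⇒x≈y δ≈0))

  i : Carrier
  i = proj₁ (inverse δ δ≉0)

  δi≈1 : δ * i ≈ 1#
  δi≈1 = proj₂ (inverse δ δ≉0)

  -- The hypothesis is the vanishing of the pivot 3 - μ - 2/(1 - μ) above two leaves, that is μ² -
  -- 4μ + 1 = 0. Subtracting it from `Q` gives μ = 0, and then `Q` reads 1 = 0.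
  double-root : (ι 3 - μ) * δ - ι 2 ≈ 0# → ¬ Q
  double-root h hQ = 0≉1 (begin
    0#                                      ≈⟨ hQ ⟨
    (μ * μ - ι 3 * μ) + 1#                  ≈⟨ +-congʳ (+-cong (*-congʳ μ≈0) (-‿cong (*-congˡ μ≈0))) ⟩
    (0# * μ - ι 3 * 0#) + 1#                ≈⟨ solve 2 (λ m o → (con (ℤ.+ 0) :* m :- con (ℤ.+ 3) :* con (ℤ.+ 0)) :+ o := o) refl μ 1# ⟩
    1#                                      ∎)
    where
    μ≈0 : μ ≈ 0#
    μ≈0 = begin
      μ                                                         ≈⟨ solve 1 (λ m → m := ((m :* m :- con (ℤ.+ 3) :* m) :+ con (ℤ.+ 1)) :- ((con (ℤ.+ 3) :- m) :* (con (ℤ.+ 1) :- m) :- con (ℤ.+ 2))) refl μ ⟩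
      ((μ * μ - ι 3 * μ) + ι 1) - ((ι 3 - μ) * (ι 1 - μ) - ι 2) ≈⟨ +-cong (trans (+-congˡ (+-identityʳ 1#)) hQ) (-‿cong (trans (+-congʳ (*-congˡ (+-congʳ (+-identityʳ 1#)))) h)) ⟩
      0# - 0#                                                   ≈⟨ -‿inverseʳ 0# ⟩
      0#                                                        ∎

  Zeros : (A → Carrier) → List A → Set ℓ
  Zeros x = All (λ v → x v ≈ 0#)

  sumRoots : (A → Carrier) → List (Rose A) → Carrier
  sumRoots x ts = sumOver x (map root ts)

  -- x satisfies the eigenvalue equations at all vertices of t, y being the value at the parent of its root.
  Sat  : (A → Carrier) → Carrier → Rose A → Set ℓ
  SatF : (A → Carrier) → Carrier → List (Rose A) → Set ℓ
  Sat x y (node v ts) = (ι (suc (length ts)) - μ) * x v ≈ y + sumRoots x ts × SatF x (x v) ts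
  SatF x y []       = ⊤
  SatF x y (t ∷ ts) = Sat x y t × SatF x y ts

  -- The three kinds of branches, seen from the vertex above: for N the pivot a is invertible and the root value is y / a;
  -- for Z the pivot vanishes, so y = 0 and the root value is free; for P some child branch is Z, so the root value is 0.
  -- S collects free vertices whose values determine the branch (for Z together with its root), one Z child of each P
  -- being left out. The excess e is the contribution to n − 2m beyond its least value 1, 0, 3; for Z the constant is 2
  -- since its root is one more free vertex.
  record NInfo (t : Rose A) : Set (c ⊔ ℓ) where
    field
      a     : Carrier
      a≉0   : a ≉0
      S     : List A
      det   : ∀ {x y} → Sat x y t → a * x (root t) ≈ y
      force : ∀ {x y} → Sat x y t → x (root t) ≈ 0# → Zeros x S → Zeros x (verts t)
      e     : ℕ
      size  : length (verts t) ≡ 2 *ℕ length S +ℕ (1 +ℕ e)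
      e≡0   : e ≡ 0 → Leaf t × a ≈ δ
      e≡1   : e ≡ 1 → ¬ Q
      -- A free vertex in a branch of kind N lies below some P vertex. That P branch contributes 2
      -- more than an N branch would, and the vertex above it adds at least 1.
      free  : S ≡ [] ⊎ 3 ≤ℕ e

  record ZInfo (t : Rose A) : Set (c ⊔ ℓ) where
    field
      S     : List A
      det   : ∀ {x y} → Sat x y t → y ≈ 0#
      force : ∀ {x y} → Sat x y t → x (root t) ≈ 0# → Zeros x S → Zeros x (verts t)
      e     : ℕ
      size  : length (verts t) ≡ 2 *ℕ length S +ℕ (2 +ℕ e)
      e≡0   : e ≡ 0 → Leg t × Q
      e≡1   : e ≡ 1 → S ≡ [] × ¬ Q

  record PInfo (t : Rose A) : Set (c ⊔ ℓ) where
    field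
      S     : List A
      det   : ∀ {x y} → Sat x y t → x (root t) ≈ 0#
      force : ∀ {x y} → Sat x y t → y ≈ 0# → Zeros x S → Zeros x (verts t)
      e     : ℕ
      size  : length (verts t) ≡ 2 *ℕ length S +ℕ (3 +ℕ e)
      e≡0   : e ≡ 0 → Q

  -- The branches below one vertex with value y: without, or with, a branch of kind Z among them.
  record NForest (ts : List (Rose A)) : Set (c ⊔ ℓ) where
    field
      s     : Carrier
      S     : List A
      det   : ∀ {x y} → SatF x y ts → sumRoots x ts ≈ s * y
      force : ∀ {x y} → SatF x y ts → y ≈ 0# → Zeros x S → Zeros x (vertsF ts)
      e     : ℕ
      size  : length (vertsF ts) ≡ 2 *ℕ length S +ℕ (length ts +ℕ e)
      e≡0   : e ≡ 0 → All Leaf ts × s ≈ ι (length ts) * i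
      e≡1   : e ≡ 1 → length ts ≡ 1 → ¬ Q
      free  : S ≡ [] ⊎ 2 ≤ℕ e
      -- If some vertex is free, there is one P branch of excess 0 and all other branches are
      -- leaves, so that s = (length ts - 1)/(1 - μ).
      e≡2   : e ≡ 2 → S ≡ [] ⊎ (Q × s + i ≈ ι (length ts) * i)

  record ZForest (ts : List (Rose A)) : Set (c ⊔ ℓ) where
    field
      S     : List A
      det   : ∀ {x y} → SatF x y ts → y ≈ 0#
      force : ∀ {x y} → SatF x y ts → sumRoots x ts ≈ 0# → Zeros x S → Zeros x (vertsF ts)
      e     : ℕ
      size  : length (vertsF ts) ≡ 2 *ℕ length S +ℕ (2 +ℕ e)
      e≡0   : e ≡ 0 → All Leg ts × Q
      -- Either a leaf stands beside the legs, or the forest is a single Z branch on three vertices;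
      -- a leg beside the latter would force `Q`.
      e≡1   : e ≡ 1 → (LegsLeaf ts × Q) ⊎ (length (vertsF ts) ≡ 3 × ¬ Q)

  data Info (t : Rose A) : Set (c ⊔ ℓ) where
    N : NInfo t → Info t
    Z : ZInfo t → Info t
    P : PInfo t → Info t

  data InfoF (ts : List (Rose A)) : Set (c ⊔ ℓ) where
    N : NForest ts → InfoF ts
    Z : ZForest ts → InfoF ts

  private
    x+y≈0⇒y≈0 : ∀ {x y} → x + y ≈ 0# → x ≈ 0# → y ≈ 0#
    x+y≈0⇒y≈0 {x} {y} h x≈0 = trans (sym (+-identityˡ y)) (trans (+-congʳ (sym x≈0)) h)

    []-excess : (f : NForest []) → NForest.e f ≡ 0
    []-excess f = proj₂ (+≡0 (2 *ℕ length (NForest.S f)) (≡.sym (NForest.size f)))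

  nilN : NForest []
  nilN = record
    { s = 0# ; S = []
    ; det = λ {x} {y} _ → sym (zeroˡ y)
    ; force = λ _ _ _ → []
    ; e = 0 ; size = ≡.refl
    ; e≡0 = λ _ → [] , sym (zeroˡ i)
    ; e≡1 = λ ()
    ; free = inj₁ ≡.refl
    ; e≡2 = λ ()
    }

  N∷N : ∀ {t ts} → NInfo t → NForest ts → NForest (t ∷ ts)
  N∷N {t} {ts} nt nts with inverse (NInfo.a nt) (NInfo.a≉0 nt)
  ... | b , ab≈1 = record
    { s = b + T.s ; S = t.S ++ T.S
    ; det = λ {x} {y} (sat , sats) → trans (+-cong (solve-root sat) (T.det sats)) (sym (distribʳ y b T.s))
    ; force = λ {x} {y} (sat , sats) y≈0 zs →
        Allₚ.++⁺ (t.force sat (trans (solve-root sat) (trans (*-congˡ y≈0) (zeroʳ b))) (Allₚ.++⁻ˡ t.S zs))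
                 (T.force sats y≈0 (Allₚ.++⁻ʳ t.S zs))
    ; e = t.e +ℕ T.e
    ; size = length-++-combine (verts t) t.S t.size T.size (arith t.e (length ts) T.e)
    ; e≡0 = zero-excess
    ; e≡1 = one-excess
    ; free = free
    ; e≡2 = two-excess
    }
    where
    module t = NInfo nt
    module T = NForest nts
    arith : ∀ e l e′ → (1 +ℕ e) +ℕ (l +ℕ e′) ≡ suc l +ℕ (e +ℕ e′)
    arith = solve-∀
    solve-root : ∀ {x y} → Sat x y t → x (root t) ≈ b * y
    solve-root {x} {y} sat = by-eq b (t.det sat) (by-eq (- x (root t)) (trans ab≈1 (sym ι1≈1))
      (solve 4 (λ a b x y → x := (b :* y :+ b :* (a :* x :- y)) :+ (:- x) :* (a :* b :- con (ℤ.+ 1))) refl t.a b (x (root t)) y))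
    b≈i : t.a ≈ δ → b ≈ i
    b≈i a≈δ = x-y≈0⇒x≈y (*-cancel-0 δ≉0 (begin
      δ * (b - i)         ≈⟨ solve 3 (λ δ b i → δ :* (b :- i) := δ :* b :- δ :* i) refl δ b i ⟩
      δ * b - δ * i       ≈⟨ +-cong (*-congʳ (sym a≈δ)) (-‿cong δi≈1) ⟩
      t.a * b - 1#        ≈⟨ x≈y⇒x-y≈0 ab≈1 ⟩
      0#                  ∎))
    more : ∀ l → i + ι l * i ≈ ι (suc l) * i
    more l = by-eq (- i) (sym ι1≈1) (solve 3 (λ i l o → i :+ l :* i := (o :+ l) :* i :+ (:- i) :* (o :- con (ℤ.+ 1))) refl i (ι l) 1#)
    zero-excess : t.e +ℕ T.e ≡ 0 → All Leaf (t ∷ ts) × b + T.s ≈ ι (suc (length ts)) * i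
    zero-excess h with +≡0 t.e h
    ... | te , Te with t.e≡0 te | T.e≡0 Te
    ...   | lf , a≈δ | lfs , s≈ = lf ∷ lfs , trans (+-cong (b≈i a≈δ) s≈) (more (length ts))
    one-excess : t.e +ℕ T.e ≡ 1 → suc (length ts) ≡ 1 → ¬ Q
    one-excess h l≡ with length≡0 ts (ℕₚ.suc-injective l≡)
    ... | ≡.refl with []-excess nts
    ...   | Te rewrite Te = t.e≡1 (≡.trans (≡.sym (ℕₚ.+-identityʳ t.e)) h)
    free : t.S ++ T.S ≡ [] ⊎ 2 ≤ℕ t.e +ℕ T.e
    free with t.free | T.free
    ... | inj₁ p | inj₁ q = inj₁ (≡.cong₂ _++_ p q)
    ... | inj₂ p | _      = inj₂ (ℕₚ.≤-trans (ℕₚ.≤-trans (ℕₚ.n≤1+n 2) p) (ℕₚ.m≤m+n t.e T.e))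
    ... | inj₁ _ | inj₂ q = inj₂ (ℕₚ.≤-trans q (ℕₚ.m≤n+m T.e t.e))
    two-excess : t.e +ℕ T.e ≡ 2 → t.S ++ T.S ≡ [] ⊎ (Q × (b + T.s) + i ≈ ι (suc (length ts)) * i)
    two-excess h with +≡2 t.e h
    ... | inj₂ (inj₁ (te , Te)) = inj₁ (≡.cong₂ _++_ (small-excess t.free te (s≤s (s≤s z≤n))) (small-excess T.free Te (s≤s (s≤s z≤n))))
    ... | inj₂ (inj₂ (te , Te)) = inj₁ (≡.cong₂ _++_ (small-excess t.free te (s≤s (s≤s (s≤s z≤n)))) (small-excess T.free Te (s≤s z≤n)))
    ... | inj₁ (te , Te) with T.e≡2 Te
    ...   | inj₁ q = inj₁ (≡.cong₂ _++_ (small-excess t.free te (s≤s z≤n)) q)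
    ...   | inj₂ (hQ , s≈) = inj₂ (hQ , trans (+-assoc b T.s i) (trans (+-cong (b≈i (proj₂ (t.e≡0 te))) s≈) (more (length ts))))

  -- The root of a P branch carries the value 0 and leaves `s` unchanged. The forest counts 1 per
  -- branch, so the constant 3 of a P branch shows up as 2 units of excess.
  P∷N : ∀ {t ts} → PInfo t → NForest ts → NForest (t ∷ ts)
  P∷N {t} {ts} pt nts = record
    { s = T.s ; S = t.S ++ T.S
    ; det = λ (sat , sats) → trans (+-cong (t.det sat) (T.det sats)) (+-identityˡ _)
    ; force = λ (sat , sats) y≈0 zs → Allₚ.++⁺ (t.force sat y≈0 (Allₚ.++⁻ˡ t.S zs)) (T.force sats y≈0 (Allₚ.++⁻ʳ t.S zs))
    ; e = 2 +ℕ t.e +ℕ T.e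
    ; size = length-++-combine (verts t) t.S t.size T.size (arith t.e (length ts) T.e)
    ; e≡0 = λ ()
    ; e≡1 = λ ()
    ; free = inj₂ (s≤s (s≤s z≤n))
    ; e≡2 = λ h → inj₂ (two-excess (+≡0 t.e (ℕₚ.suc-injective (ℕₚ.suc-injective h))))
    }
    where
    module t = PInfo pt
    module T = NForest nts
    arith : ∀ e l e′ → (3 +ℕ e) +ℕ (l +ℕ e′) ≡ suc l +ℕ (2 +ℕ e +ℕ e′)
    arith = solve-∀
    two-excess : t.e ≡ 0 × T.e ≡ 0 → Q × T.s + i ≈ ι (suc (length ts)) * i
    two-excess (te , Te) = t.e≡0 te , (begin
      T.s + i                  ≈⟨ +-cong (proj₂ (T.e≡0 Te)) (sym (*-identityˡ i)) ⟩
      ι (length ts) * i + 1# * i ≈⟨ +-comm _ _ ⟩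
      1# * i + ι (length ts) * i ≈⟨ distribʳ i 1# (ι (length ts)) ⟨
      ι (suc (length ts)) * i  ∎)

  -- The root of this Z branch is the one that stays out of `S`: all N and P roots beside it vanish,
  -- so its value follows from the vanishing sum of the root values. The N forest now counts
  -- entirely as excess.
  Z∷N : ∀ {t ts} → ZInfo t → NForest ts → ZForest (t ∷ ts)
  Z∷N {t} {ts} zt nts = record
    { S = t.S ++ T.S
    ; det = λ (sat , sats) → t.det sat
    ; force = λ (sat , sats) Σ≈0 zs →
        Allₚ.++⁺ (t.force sat (x+y≈0⇒y≈0 (trans (+-comm _ _) Σ≈0) (trans (T.det sats) (trans (*-congˡ (t.det sat)) (zeroʳ T.s)))) (Allₚ.++⁻ˡ t.S zs))
                 (T.force sats (t.det sat) (Allₚ.++⁻ʳ t.S zs))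
    ; e = t.e +ℕ (length ts +ℕ T.e)
    ; size = length-++-combine (verts t) t.S t.size T.size ≡.refl
    ; e≡0 = zero-excess
    ; e≡1 = λ h → one-excess (+≡1 t.e h)
    }
    where
    module t = ZInfo zt
    module T = NForest nts
    zero-excess : t.e +ℕ (length ts +ℕ T.e) ≡ 0 → All Leg (t ∷ ts) × Q
    zero-excess h with +≡0 t.e h
    ... | te , lTe with length≡0 ts (proj₁ (+≡0 (length ts) lTe))
    ...   | ≡.refl = proj₁ (t.e≡0 te) ∷ [] , proj₂ (t.e≡0 te)
    one-excess : (t.e ≡ 0 × length ts +ℕ T.e ≡ 1) ⊎ (t.e ≡ 1 × length ts +ℕ T.e ≡ 0) →
      (LegsLeaf (t ∷ ts) × Q) ⊎ (length (vertsF (t ∷ ts)) ≡ 3 × ¬ Q)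
    one-excess (inj₂ (te , lTe)) with length≡0 ts (proj₁ (+≡0 (length ts) lTe))
    ... | ≡.refl = inj₂ (size3 , proj₂ (t.e≡1 te))
      where
      size3 : length (verts t ++ []) ≡ 3
      size3 = ≡.trans (≡.cong length (Listₚ.++-identityʳ (verts t)))
        (≡.trans t.size (≡.cong₂ (λ S e → 2 *ℕ length S +ℕ (2 +ℕ e)) (proj₁ (t.e≡1 te)) te))
    one-excess (inj₁ (te , lTe)) = go ts nts lTe
      where
      go : ∀ ts (nts : NForest ts) → length ts +ℕ NForest.e nts ≡ 1 → (LegsLeaf (t ∷ ts) × Q) ⊎ (length (vertsF (t ∷ ts)) ≡ 3 × ¬ Q)
      go [] nts h with ≡.trans (≡.sym ([]-excess nts)) h
      ... | ()
      go (u ∷ us) nts h with +≡0 (length us) (ℕₚ.suc-injective h)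
      ... | lu , Te with length≡0 us lu | NForest.e≡0 nts Te
      ...   | ≡.refl | lf ∷ [] , _ = inj₁ (there (proj₁ (t.e≡0 te)) (here lf []) , proj₂ (t.e≡0 te))

  N∷Z : ∀ {t ts} → NInfo t → ZForest ts → ZForest (t ∷ ts)
  N∷Z {t} {ts} nt zts = record
    { S = t.S ++ T.S
    ; det = λ (sat , sats) → T.det sats
    ; force = λ (sat , sats) Σ≈0 zs →
        let xt≈0 = *-cancel-0 t.a≉0 (trans (t.det sat) (T.det sats)) in
        Allₚ.++⁺ (t.force sat xt≈0 (Allₚ.++⁻ˡ t.S zs)) (T.force sats (x+y≈0⇒y≈0 Σ≈0 xt≈0) (Allₚ.++⁻ʳ t.S zs))
    ; e = suc (t.e +ℕ T.e)
    ; size = length-++-combine (verts t) t.S t.size T.size (arith t.e T.e)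
    ; e≡0 = λ ()
    ; e≡1 = λ h → one-excess (+≡0 t.e (ℕₚ.suc-injective h))
    }
    where
    module t = NInfo nt
    module T = ZForest zts
    arith : ∀ e e′ → (1 +ℕ e) +ℕ (2 +ℕ e′) ≡ 2 +ℕ suc (e +ℕ e′)
    arith = solve-∀
    one-excess : t.e ≡ 0 × T.e ≡ 0 → (LegsLeaf (t ∷ ts) × Q) ⊎ (length (vertsF (t ∷ ts)) ≡ 3 × ¬ Q)
    one-excess (te , Te) with T.e≡0 Te
    ... | legs , hQ = inj₁ (here (proj₁ (t.e≡0 te)) legs , hQ)

  P∷Z : ∀ {t ts} → PInfo t → ZForest ts → ZForest (t ∷ ts)
  P∷Z {t} {ts} pt zts = record
    { S = t.S ++ T.S
    ; det = λ (sat , sats) → T.det sats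
    ; force = λ (sat , sats) Σ≈0 zs →
        Allₚ.++⁺ (t.force sat (T.det sats) (Allₚ.++⁻ˡ t.S zs)) (T.force sats (x+y≈0⇒y≈0 Σ≈0 (t.det sat)) (Allₚ.++⁻ʳ t.S zs))
    ; e = 3 +ℕ (t.e +ℕ T.e)
    ; size = length-++-combine (verts t) t.S t.size T.size (arith t.e T.e)
    ; e≡0 = λ ()
    ; e≡1 = λ ()
    }
    where
    module t = PInfo pt
    module T = ZForest zts
    arith : ∀ e e′ → (3 +ℕ e) +ℕ (2 +ℕ e′) ≡ 2 +ℕ (3 +ℕ (e +ℕ e′))
    arith = solve-∀

  -- Every further Z root is a free vertex. Two Z branches have constants 2 + 2, and the added free
  -- vertex absorbs 2 of them.
  Z∷Z : ∀ {t ts} → ZInfo t → ZForest ts → ZForest (t ∷ ts)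
  Z∷Z {t} {ts} zt zts = record
    { S = root t ∷ t.S ++ T.S
    ; det = λ (sat , sats) → T.det sats
    ; force = λ { (sat , sats) Σ≈0 (xt≈0 ∷ zs) →
        Allₚ.++⁺ (t.force sat xt≈0 (Allₚ.++⁻ˡ t.S zs)) (T.force sats (x+y≈0⇒y≈0 Σ≈0 xt≈0) (Allₚ.++⁻ʳ t.S zs)) }
    ; e = t.e +ℕ T.e
    ; size = ≡.trans (length-++-combine (verts t) t.S t.size T.size (arith t.e T.e)) (arith′ (length (t.S ++ T.S)) (t.e +ℕ T.e))
    ; e≡0 = λ h → zero-excess (+≡0 t.e h)
    ; e≡1 = λ h → one-excess (+≡1 t.e h)
    }
    where
    module t = ZInfo zt
    module T = ZForest zts
    arith : ∀ e e′ → (2 +ℕ e) +ℕ (2 +ℕ e′) ≡ 2 +ℕ (2 +ℕ (e +ℕ e′))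
    arith = solve-∀
    arith′ : ∀ s e → 2 *ℕ s +ℕ (2 +ℕ (2 +ℕ e)) ≡ 2 *ℕ suc s +ℕ (2 +ℕ e)
    arith′ = solve-∀
    zero-excess : t.e ≡ 0 × T.e ≡ 0 → All Leg (t ∷ ts) × Q
    zero-excess (te , Te) with t.e≡0 te | T.e≡0 Te
    ... | lg , _ | lgs , hQ = lg ∷ lgs , hQ
    one-excess : (t.e ≡ 0 × T.e ≡ 1) ⊎ (t.e ≡ 1 × T.e ≡ 0) → (LegsLeaf (t ∷ ts) × Q) ⊎ (length (vertsF (t ∷ ts)) ≡ 3 × ¬ Q)
    one-excess (inj₂ (te , Te)) = ⊥-elim (proj₂ (t.e≡1 te) (proj₂ (T.e≡0 Te)))
    one-excess (inj₁ (te , Te)) with t.e≡0 te | T.e≡1 Te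
    ... | lg , hQ | inj₂ (_ , ¬Q)  = ⊥-elim (¬Q hQ)
    ... | lg , _  | inj₁ (lgs , hQ) = inj₁ (there lg lgs , hQ)

  leafN : ∀ v → NInfo (node v [])
  leafN v = record
    { a = ι 1 - μ
    ; a≉0 = λ h → δ≉0 (trans (+-congʳ (sym (+-identityʳ 1#))) h)
    ; S = []
    ; det = λ (eq , _) → trans eq (+-identityʳ _)
    ; force = λ _ xv≈0 _ → xv≈0 ∷ []
    ; e = 0 ; size = ≡.refl
    ; e≡0 = λ _ → leaf , +-congʳ (+-identityʳ 1#)
    ; e≡1 = λ ()
    ; free = inj₁ ≡.refl
    }

  nodeP : ∀ {v ts} → ZForest ts → PInfo (node v ts)
  nodeP {v} {ts} zts = record
    { S = T.S
    ; det = λ (_ , sats) → T.det sats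
    ; force = λ (eq , sats) y≈0 zs → let xv≈0 = T.det sats in
        xv≈0 ∷ T.force sats (x+y≈0⇒y≈0 (trans (sym eq) (trans (*-congˡ xv≈0) (zeroʳ _))) y≈0) zs
    ; e = T.e
    ; size = ≡.trans (≡.cong suc T.size) (arith (length T.S) T.e)
    ; e≡0 = λ h → proj₂ (T.e≡0 h)
    }
    where
    module T = ZForest zts
    arith : ∀ s e → suc (2 *ℕ s +ℕ (2 +ℕ e)) ≡ 2 *ℕ s +ℕ (3 +ℕ e)
    arith = solve-∀

  module NodeN {v : A} {t ts} (nts : NForest (t ∷ ts)) where
    private
      module T = NForest nts
      l = length ts

    a : Carrier
    a = (ι (2 +ℕ l) - μ) - T.s

    det : ∀ {x y} → Sat x y (node v (t ∷ ts)) → a * x v ≈ y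
    det {x} {y} (eq , sats) = begin
      a * x v                                  ≈⟨ solve 3 (λ d s x → (d :- s) :* x := d :* x :- s :* x) refl (ι (2 +ℕ l) - μ) T.s (x v) ⟩
      (ι (2 +ℕ l) - μ) * x v - T.s * x v       ≈⟨ +-cong (trans eq (+-congˡ (T.det sats))) refl ⟩
      (y + T.s * x v) - T.s * x v              ≈⟨ solve 2 (λ y z → (y :+ z) :- z := y) refl y (T.s * x v) ⟩
      y                                        ∎

    force : ∀ {x y} → Sat x y (node v (t ∷ ts)) → x v ≈ 0# → Zeros x T.S → Zeros x (v ∷ vertsF (t ∷ ts))
    force (eq , sats) xv≈0 zs = xv≈0 ∷ T.force sats xv≈0 zs

    private
      -- The pivot above leaves only, multiplied by 1 - μ to clear the denominator.
      δa : ∀ {k} → l ≡ k → T.s ≈ ι (suc l) * i → δ * a ≈ (ι (2 +ℕ k) - μ) * δ - ι (suc k)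
      δa ≡.refl s≈ = trans (*-congˡ (+-congˡ (-‿cong s≈))) (by-eq (- ι (suc l)) (trans δi≈1 (sym ι1≈1))
        (solve 4 (λ δ i m p → δ :* (p :- m :* i) := (p :* δ :- m) :+ (:- m) :* (δ :* i :- con (ℤ.+ 1))) refl δ i (ι (suc l)) (ι (2 +ℕ l) - μ)))

      one-leaf : l ≡ 0 → T.e ≡ 0 → δ * a ≈ (μ * μ - ι 3 * μ) + 1#
      one-leaf l≡0 e≡0 = trans (δa l≡0 (proj₂ (T.e≡0 e≡0))) (by-eq (ι 1 - μ) (sym ι1≈1) (solve 2 (λ m o →
        (con (ℤ.+ 2) :- m) :* (o :- m) :- con (ℤ.+ 1) := ((m :* m :- con (ℤ.+ 3) :* m) :+ o) :+ (con (ℤ.+ 1) :- m) :* (o :- con (ℤ.+ 1))) refl μ 1#))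

      two-leaves : l ≡ 1 → T.e ≡ 0 → a ≈ 0# → ¬ Q
      two-leaves l≡1 e≡0 a≈0 = double-root (trans (sym (δa l≡1 (proj₂ (T.e≡0 e≡0)))) (trans (*-congˡ a≈0) (zeroʳ δ)))

      arith : ∀ s l e → suc (2 *ℕ s +ℕ (suc l +ℕ e)) ≡ 2 *ℕ s +ℕ (1 +ℕ (suc l +ℕ e))
      arith = solve-∀
      arith′ : ∀ s l e → suc (2 *ℕ s +ℕ (suc l +ℕ e)) ≡ 2 *ℕ s +ℕ (2 +ℕ (l +ℕ e))
      arith′ = solve-∀

    nodeN : a ≉0 → NInfo (node v (t ∷ ts))
    nodeN a≉0 = record
      { a = a ; a≉0 = a≉0 ; S = T.S ; det = det ; force = force
      ; e = suc l +ℕ T.e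
      ; size = ≡.trans (≡.cong suc T.size) (arith (length T.S) l T.e)
      ; e≡0 = λ ()
      -- Excess 1 means a single leaf child, and then `Q` would make the pivot vanish.
      ; e≡1 = λ h hQ → let (l≡0 , e≡0) = +≡0 l (ℕₚ.suc-injective h) in a≉0 (*-cancel-0 δ≉0 (trans (one-leaf l≡0 e≡0) hQ))
      ; free = [ inj₁ , (λ 2≤e → inj₂ (s≤s (ℕₚ.≤-trans 2≤e (ℕₚ.m≤n+m T.e l)))) ]′ T.free
      }

    nodeZ : a ≈ 0# → ZInfo (node v (t ∷ ts))
    nodeZ a≈0 = record
      { S = T.S
      ; det = λ {x} sat → trans (sym (det sat)) (trans (*-congʳ a≈0) (zeroˡ (x v)))
      ; force = force
      ; e = l +ℕ T.e
      ; size = ≡.trans (≡.cong suc T.size) (arith′ (length T.S) l T.e)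
      ; e≡0 = λ h → zero-excess (+≡0 l h)
      ; e≡1 = λ h → one-excess (+≡1 l h)
      }
      where
      zero-excess : l ≡ 0 × T.e ≡ 0 → Leg (node v (t ∷ ts)) × Q
      zero-excess (l≡0 , e≡0) = isLeg (length≡0 ts l≡0) (proj₁ (T.e≡0 e≡0)) ,
        trans (sym (one-leaf l≡0 e≡0)) (trans (*-congˡ a≈0) (zeroʳ δ))
        where
        isLeg : ts ≡ [] → All Leaf (t ∷ ts) → Leg (node v (t ∷ ts))
        isLeg ≡.refl (leaf ∷ []) = leg
      -- The two shapes on three vertices: a path hanging by its end, and a vertex with two leaves.
      one-excess : (l ≡ 0 × T.e ≡ 1) ⊎ (l ≡ 1 × T.e ≡ 0) → T.S ≡ [] × ¬ Q
      one-excess (inj₁ (l≡0 , e≡1)) = small-excess T.free e≡1 (s≤s (s≤s z≤n)) , T.e≡1 e≡1 (≡.cong suc l≡0)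
      one-excess (inj₂ (l≡1 , e≡0)) = small-excess T.free e≡0 (s≤s z≤n) , two-leaves l≡1 e≡0 a≈0

  info  : ∀ t → Info t
  infoF : ∀ ts → InfoF ts
  info (node v []) = N (leafN v)
  info (node v (t ∷ ts)) with infoF (t ∷ ts)
  ... | Z zts = P (nodeP zts)
  ... | N nts with NodeN.a {v = v} nts ≈? 0#
  ...   | yes a≈0 = Z (NodeN.nodeZ nts a≈0)
  ...   | no  a≉0 = N (NodeN.nodeN nts a≉0)
  infoF [] = N nilN
  infoF (t ∷ ts) with info t | infoF ts
  ... | N nt | N nts = N (N∷N nt nts)
  ... | P pt | N nts = N (P∷N pt nts)
  ... | Z zt | N nts = Z (Z∷N zt nts)
  ... | N nt | Z zts = Z (N∷Z nt zts)
  ... | P pt | Z zts = Z (P∷Z pt zts)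
  ... | Z zt | Z zts = Z (Z∷Z zt zts)

-- Extremal trees

module _ {n} {G : Graph n} where

  private
    disjoint : ∀ {us : List (Fin n)} {v ts} → All (λ t → _~_ G v (root t) × root t ∉ us) ts → ∀ {j} → ¬ (j ∈ us × j ∈ map root ts)
    disjoint kid (j∈us , j∈ts) with ∈-map⁻ root j∈ts
    ... | t , t∈ , ≡.refl = proj₂ (All.lookup kid t∈) j∈us

  nbrs-unique : ∀ {us v ts} → Rep G us (node v ts) → Unique (us ++ map root ts)
  nbrs-unique (node us! _ ts! kid _ _) = Uniqueₚ.++⁺ us! ts! (disjoint kid)

  nbrs-adjacent : ∀ {us v ts} → Rep G us (node v ts) → ∀ {j} → j ∈ us ++ map root ts → _~_ G v j
  nbrs-adjacent {us} (node _ us~ _ kid _ _) j∈ with ∈-++⁻ us j∈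
  ... | inj₁ j∈us = All.lookup us~ j∈us
  ... | inj₂ j∈ts with ∈-map⁻ root j∈ts
  ...   | t , t∈ , ≡.refl = proj₁ (All.lookup kid t∈)

  nbrs-complete : ∀ {us v ts} → Rep G us (node v ts) → ∀ j → _~_ G v j → j ∈ us ++ map root ts
  nbrs-complete (node _ _ _ _ complete _) = complete

  children : ∀ {us v ts} → Rep G us (node v ts) → All (Rep G (v ∷ [])) ts
  children (node _ _ _ _ _ reps) = reps

  -- Following first children ends at a leaf of the unfolding, whose only neighbour is its parent.
  pendant : ∀ {u t} → Rep G (u ∷ []) t → ∃₂ λ v w → ∀ j → _~_ G v j → j ≡ w
  pendant {u} {node v []} rep = v , u , λ j v~j → only (nbrs-complete rep j v~j)
    where
    only : ∀ {j} → j ∈ u ∷ [] → j ≡ u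
    only (here eq) = eq
  pendant {t = node v (t ∷ ts)} (node _ _ _ _ _ (rep ∷ _)) = pendant rep

module RootedTree {c ℓ} (F : OrderedField c ℓ) (μ : OrderedField.Carrier F)
  (μ≉1 : ¬ (OrderedField._≈_ F μ (OrderedField.1# F))) {n} {G : Graph n} (tree : IsTree G) where
  open FieldKit F
  open LinAlg F
  open Elimination F μ μ≉1 {Fin n}
  open import Relation.Binary.Reasoning.Setoid setoid

  private
    Eig : (Fin n → Carrier) → Set ℓ
    Eig = IsLapEigenvector F G μ

  node-equation : ∀ {x us v ts} → Eig x → Rep G us (node v ts) →
    (ι (length (us ++ map root ts)) - μ) * x v ≈ sumOver x (us ++ map root ts)
  node-equation {x} {us} {v} {ts} eig rep = by-eq (ι 1) (trans (sym (laplacian-local G x v (nbrs-unique rep) (nbrs-complete rep) (nbrs-adjacent rep))) (eig v))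
    (solve 4 (λ d m x s → (d :- m) :* x := s :+ con (ℤ.+ 1) :* ((d :* x :- s) :- m :* x)) refl (ι (length (us ++ map root ts))) μ (x v) _)

  rep⇒Sat  : ∀ {x u t} → Eig x → Rep G (u ∷ []) t → Sat x (x u) t
  rep⇒SatF : ∀ {x u ts} → Eig x → All (Rep G (u ∷ [])) ts → SatF x (x u) ts
  rep⇒Sat {x} {t = node v ts} eig rep@(node _ _ _ _ _ reps) =
    trans (reflexive (≡.cong (λ k → (ι (suc k) - μ) * x v) (≡.sym (Listₚ.length-map root ts)))) (node-equation eig rep) ,
    rep⇒SatF eig reps
  rep⇒SatF eig [] = tt
  rep⇒SatF eig (rep ∷ reps) = rep⇒Sat eig rep , rep⇒SatF eig reps

  private
    *0 : ∀ {x y} → y ≈ 0# → x * y ≈ 0#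
    *0 {x} y≈0 = trans (*-congˡ y≈0) (zeroʳ x)

    -- A root of kind Z with three children, one P and two leaves, has s = 2/(1 - μ): the same
    -- equation as for a vertex with a parent and two leaves.
    two-leaves-and-hub : ∀ {s} → (ι 3 - μ) - s ≈ 0# → s + i ≈ ι 3 * i → (ι 3 - μ) * δ - ι 2 ≈ 0#
    two-leaves-and-hub {s} a≈0 s≈ = begin
      (ι 3 - μ) * δ - ι 2
        ≈⟨ solve 4 (λ d i m s → (con (ℤ.+ 3) :- m) :* d :- con (ℤ.+ 2) :=
             (d :* ((con (ℤ.+ 3) :- m) :- s) :+ d :* ((s :+ i) :- con (ℤ.+ 3) :* i)) :+ con (ℤ.+ 2) :* (d :* i :- con (ℤ.+ 1))) refl δ i μ s ⟩
      (δ * ((ι 3 - μ) - s) + δ * ((s + i) - ι 3 * i)) + ι 2 * (δ * i - ι 1)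
        ≈⟨ +-cong (+-cong (*0 a≈0) (*0 (x≈y⇒x-y≈0 s≈))) (*0 (x≈y⇒x-y≈0 (trans δi≈1 (sym (+-identityʳ 1#))))) ⟩
      (0# + 0#) + 0#  ≈⟨ trans (+-identityʳ _) (+-identityʳ _) ⟩
      0#              ∎

  module _ {r ts} (rep : Rep G [] (node r ts)) where

    root-equation : ∀ {x} → Eig x → (ι (length ts) - μ) * x r ≈ sumRoots x ts
    root-equation {x} eig = trans (reflexive (≡.cong (λ k → (ι k - μ) * x r) (≡.sym (Listₚ.length-map root ts)))) (node-equation eig rep)

    root-SatF : ∀ {x} → Eig x → SatF x (x r) ts
    root-SatF eig = rep⇒SatF eig (children rep)

    all-zero : ∀ {x} → Zeros x (r ∷ vertsF ts) → ∀ j → x j ≈ 0#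
    all-zero zs j = All.lookup zs (covers G (proj₁ tree) rep j)

    order : suc (length (vertsF ts)) ≡ n
    order = verts-length G tree rep

    module _ {m} (vecs : HasIndepEigenvectors F G μ m) (n≡ : n ≡ 2 *ℕ m +ℕ 4) (8≤n : 8 ≤ℕ n) where

      private
        4≤2m : 4 ≤ℕ 2 *ℕ m
        4≤2m = ℕₚ.+-cancelʳ-≤ 4 4 (2 *ℕ m) (≡.subst (8 ≤ℕ_) n≡ 8≤n)

        bound : ∀ {S} → Forces Eig S → 2 *ℕ m ≤ℕ 2 *ℕ length S
        bound forces = ℕₚ.*-monoʳ-≤ 2 (multiplicity≤ G μ vecs forces)

        -- Here e′ is twice the number of forcing vertices used besides `S`: 2 if the root value
        -- must be fixed as well, 0 otherwise.
        excess-bound : ∀ {s e e′} → suc (2 *ℕ s +ℕ e) ≡ 2 *ℕ m +ℕ 4 → 2 *ℕ m ≤ℕ 2 *ℕ s +ℕ e′ → e ≤ℕ 3 +ℕ e′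
        excess-bound {s} {e} {e′} h m≤ = ℕₚ.+-cancelˡ-≤ (2 *ℕ s) e (3 +ℕ e′) (ℕₚ.≤-trans (ℕₚ.≤-reflexive (ℕₚ.suc-injective (≡.trans h (ar₁ (2 *ℕ m)))))
          (ℕₚ.≤-trans (ℕₚ.+-monoˡ-≤ 3 m≤) (ℕₚ.≤-reflexive (ar₂ (2 *ℕ s) e′))))
          where
          ar₁ : ∀ m → m +ℕ 4 ≡ suc (m +ℕ 3)
          ar₁ = solve-∀
          ar₂ : ∀ s e → s +ℕ e +ℕ 3 ≡ s +ℕ (3 +ℕ e)
          ar₂ = solve-∀

        -- A root of kind P adds no forcing vertex, so the excess is at most 1. Excess 0 would make
        -- n odd, and the three-vertex alternative for excess 1 would give n = 4.
        spiderZ : ZForest ts → LegsLeaf ts × Q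
        spiderZ zts = finish
          where
          open ZForest zts
          forces : Forces Eig S
          forces eig zs = all-zero (xr≈0 ∷ force (root-SatF eig) (trans (sym (root-equation eig)) (trans (*-congˡ xr≈0) (zeroʳ _))) zs)
            where xr≈0 = det (root-SatF eig)
          size′ : suc (2 *ℕ length S +ℕ (2 +ℕ e)) ≡ 2 *ℕ m +ℕ 4
          size′ = ≡.trans (≡.cong suc (≡.sym size)) (≡.trans order n≡)
          e≤1 : e ≤ℕ 1
          e≤1 = ℕₚ.+-cancelˡ-≤ 2 e 1 (excess-bound {length S} {2 +ℕ e} {0} size′ (≡.subst (2 *ℕ m ≤ℕ_) (≡.sym (ℕₚ.+-identityʳ _)) (bound forces)))
          odd : ∀ s m → ¬ suc (2 *ℕ s +ℕ 2) ≡ 2 *ℕ m +ℕ 4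
          odd s m h = ℕₚ.even≢odd (m +ℕ 2) (suc s) (≡.trans (ar₁ m) (≡.trans (≡.sym h) (ar₂ s)))
            where
            ar₁ : ∀ m → 2 *ℕ (m +ℕ 2) ≡ 2 *ℕ m +ℕ 4
            ar₁ = solve-∀
            ar₂ : ∀ s → suc (2 *ℕ s +ℕ 2) ≡ suc (2 *ℕ suc s)
            ar₂ = solve-∀
          large : ¬ length (vertsF ts) ≡ 3
          large size≡3 = ℕₚ.<⇒≱ (s≤s (s≤s (s≤s (s≤s (s≤s z≤n))))) (≡.subst (8 ≤ℕ_) (≡.trans (≡.sym order) (≡.cong suc size≡3)) 8≤n)
          finish : LegsLeaf ts × Q
          finish = [ (λ e<1 → ⊥-elim (odd (length S) m (≡.subst (λ e → suc (2 *ℕ length S +ℕ (2 +ℕ e)) ≡ 2 *ℕ m +ℕ 4) (ℕₚ.n<1⇒n≡0 e<1) size′)))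
                   , (λ e≡1′ → [ id , ⊥-elim ∘ large ∘ proj₁ ]′ (e≡1 e≡1′)) ]′ (ℕₚ.m≤n⇒m<n∨m≡n e≤1)

        -- A nonzero root pivot would require l + e ≤ 3, but l ≥ 3 and e ≥ 2. A zero pivot requires
        -- l + e ≤ 5, so l = 3 and e = 2, which leaves only two leaves and a P branch.
        ¬spiderN : 3 ≤ℕ length ts → ¬ NForest ts
        ¬spiderN 3≤l nts = finish free
          where
          open NForest nts
          l = length ts
          a : Carrier
          -- The root has no parent, so its degree is l and not l + 1.
          a = (ι l - μ) - s
          det-root : ∀ {x} → Eig x → a * x r ≈ 0#
          det-root {x} eig = trans (solve 3 (λ d s x → (d :- s) :* x := d :* x :- s :* x) refl (ι l - μ) s (x r))
            (x≈y⇒x-y≈0 (trans (root-equation eig) (det (root-SatF eig))))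
          forces₁ : Forces Eig (r ∷ S)
          forces₁ eig (xr≈0 ∷ zs) = all-zero (xr≈0 ∷ force (root-SatF eig) xr≈0 zs)
          forces₀ : a ≉0 → Forces Eig S
          forces₀ a≉0 eig zs = forces₁ eig (*-cancel-0 a≉0 (det-root eig) ∷ zs)
          size′ : suc (2 *ℕ length S +ℕ (l +ℕ e)) ≡ 2 *ℕ m +ℕ 4
          size′ = ≡.trans (≡.cong suc (≡.sym size)) (≡.trans order n≡)
          l+e≤5 : l +ℕ e ≤ℕ 5
          l+e≤5 = excess-bound {length S} {l +ℕ e} {2} size′ (≡.subst (2 *ℕ m ≤ℕ_) (ar (length S)) (bound forces₁))
            where
            ar : ∀ s → 2 *ℕ suc s ≡ 2 *ℕ s +ℕ 2
            ar = solve-∀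
          -- Without free vertices the root alone forces, so m ≤ 1, whereas n ≥ 8 gives m ≥ 2.
          no-free : ¬ S ≡ []
          no-free S≡[] = ℕₚ.<⇒≱ (s≤s (s≤s (s≤s z≤n))) (ℕₚ.≤-trans 4≤2m (≡.subst (λ S → 2 *ℕ m ≤ℕ 2 *ℕ suc (length S)) S≡[] (bound forces₁)))
          finish : S ≡ [] ⊎ 2 ≤ℕ e → ⊥
          finish (inj₁ S≡[]) = no-free S≡[]
          finish (inj₂ 2≤e) = pivot≈0 pivot≉0
            where
            pivot≈0 : ¬ a ≉0
            pivot≈0 a≉0 = ℕₚ.<⇒≱ (s≤s (s≤s (s≤s (s≤s z≤n)))) (ℕₚ.≤-trans (ℕₚ.+-mono-≤ 3≤l 2≤e)
              (excess-bound {length S} {l +ℕ e} {0} size′ (≡.subst (2 *ℕ m ≤ℕ_) (≡.sym (ℕₚ.+-identityʳ _)) (bound (forces₀ a≉0)))))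
            l≡3 : l ≡ 3
            l≡3 = ℕₚ.≤-antisym (ℕₚ.+-cancelʳ-≤ 2 l 3 (ℕₚ.≤-trans (ℕₚ.+-monoʳ-≤ l 2≤e) l+e≤5)) 3≤l
            e≡2′ : e ≡ 2
            e≡2′ = ℕₚ.≤-antisym (ℕₚ.+-cancelˡ-≤ 3 e 2 (ℕₚ.≤-trans (ℕₚ.+-monoˡ-≤ e 3≤l) l+e≤5)) 2≤e
            pivot≉0 : a ≉0
            pivot≉0 a≈0 = [ no-free , (λ (hQ , s≈) → double-root (two-leaves-and-hub
              (≡.subst (λ l → (ι l - μ) - s ≈ 0#) l≡3 a≈0) (≡.subst (λ l → s + i ≈ ι l * i) l≡3 s≈)) hQ) ]′ (e≡2 e≡2′)

      spider-at-hub : 3 ≤ℕ length ts → LegsLeaf ts × Q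
      spider-at-hub 3≤l with infoF ts
      ... | Z zts = spiderZ zts
      ... | N nts = ⊥-elim (¬spiderN 3≤l nts)

  -- With all degrees at most 2 the tree is a path, and an eigenvector vanishing at an end vanishes everywhere.
  module _ (thin : ∀ v {l} → Unique l → All (_~_ G v) l → length l ≤ℕ 2) where

    path-zero : ∀ {x u t} → Eig x → Rep G (u ∷ []) t → x u ≈ 0# → x (root t) ≈ 0# → Zeros x (verts t)
    path-zero {t = node v []} eig rep xu≈0 xv≈0 = xv≈0 ∷ []
    path-zero {x} {u} {node v (t ∷ [])} eig rep xu≈0 xv≈0 =
      xv≈0 ∷ Allₚ.++⁺ (path-zero eig (All.head (children rep)) xv≈0 xt≈0) []
      where
      xt≈0 : x (root t) ≈ 0#
      xt≈0 = begin
        x (root t)                 ≈⟨ trans (+-identityˡ _) (+-identityʳ _) ⟨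
        0# + (x (root t) + 0#)     ≈⟨ +-congʳ xu≈0 ⟨
        x u + (x (root t) + 0#)    ≈⟨ node-equation eig rep ⟨
        (ι 2 - μ) * x v            ≈⟨ trans (*-congˡ xv≈0) (zeroʳ _) ⟩
        0#                         ∎
    path-zero {t = node v (_ ∷ _ ∷ _)} eig rep _ _
      with thin v (nbrs-unique rep) (All.tabulate (nbrs-adjacent rep))
    ... | s≤s (s≤s ())

    -- An end of the path is found in the unfolding from an arbitrary vertex. In a second unfolding,
    -- from that end, the root has a single child, and the root equation ties the child's value to
    -- the root's.
    path-multiplicity : 2 ≤ℕ n → ∀ {m} → HasIndepEigenvectors F G μ m → m ≤ℕ 1
    path-multiplicity (s≤s (s≤s z≤n)) vecs with unfold G (proj₂ tree) fzero
    ... | node r [] , _ , rep with () ← order rep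
    ... | node r (t ∷ ts) , _ , rep with pendant (All.head (children rep))
    ...   | v , w , only with unfold G (proj₂ tree) v
    ...     | node .v [] , ≡.refl , rep′ with () ← order rep′
    ...     | node .v (t₁ ∷ t₂ ∷ _) , ≡.refl , rep′ = ⊥-elim (distinct (nbrs-unique rep′)
                (≡.trans (only _ (nbrs-adjacent rep′ (here ≡.refl))) (≡.sym (only _ (nbrs-adjacent rep′ (there (here ≡.refl)))))))
              where
              distinct : Unique (root t₁ ∷ root t₂ ∷ _) → root t₁ ≢ root t₂
              distinct ((h ∷ _) ∷ _) = h
    path-multiplicity (s≤s (s≤s z≤n)) vecs | node r (t ∷ ts) , _ , rep | v , w , only | node .v (t₁ ∷ []) , ≡.refl , rep′ =
      multiplicity≤ G μ vecs forces
      where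
      forces : Forces Eig (v ∷ [])
      forces {x} eig (xv≈0 ∷ []) = all-zero rep′ (xv≈0 ∷ Allₚ.++⁺ (path-zero eig (All.head (children rep′)) xv≈0
        (trans (sym (+-identityʳ _)) (trans (sym (root-equation rep′ eig)) (trans (*-congˡ xv≈0) (zeroʳ _))))) [])

  private
    kidsOf : ∀ {us t} → Rep G us t → List (Rose (Fin n))
    kidsOf {t = node _ ts} _ = ts

  spider-rooted : ∀ {m} → HasIndepEigenvectors F G μ m → n ≡ 2 *ℕ m +ℕ 4 → 8 ≤ℕ n →
    ∃₂ λ r ts → Rep G [] (node r ts) × LegsLeaf ts × Q
  spider-rooted {m} vecs n≡ 8≤n with Finₚ.any? (λ v → 3 ℕ.≤? length (kidsOf (proj₂ (proj₂ (unfold G (proj₂ tree) v)))))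
  ... | yes (v , hub) with unfold G (proj₂ tree) v
  ...   | node r ts , _ , rep = r , ts , rep , spider-at-hub rep vecs n≡ 8≤n hub
  spider-rooted {m} vecs n≡ 8≤n | no thin′ = ⊥-elim (ℕₚ.<⇒≱ (s≤s (s≤s (s≤s z≤n))) (ℕₚ.≤-trans 4≤2m (ℕₚ.*-monoʳ-≤ 2 m≤1)))
    where
    4≤2m : 4 ≤ℕ 2 *ℕ m
    4≤2m = ℕₚ.+-cancelʳ-≤ 4 4 (2 *ℕ m) (≡.subst (8 ≤ℕ_) n≡ 8≤n)
    thin : ∀ v {l} → Unique l → All (_~_ G v) l → length l ≤ℕ 2
    thin v {l} l! l~ with unfold G (proj₂ tree) v | (λ h → thin′ (v , h))
    ... | node .v ts , ≡.refl , rep | ¬hub = ℕₚ.≤-trans (Unique-⊆⇒length≤ l! λ j∈ → nbrs-complete rep _ (All.lookup l~ j∈))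
      (≡.subst (_≤ℕ 2) (≡.sym (Listₚ.length-map root ts)) (ℕₚ.≮⇒≥ ¬hub))
    m≤1 : m ≤ℕ 1
    m≤1 = path-multiplicity thin (ℕₚ.≤-trans (s≤s (s≤s z≤n)) 8≤n) vecs

-- Coordinates on spiders

module Codings where
  open ≡ using (refl; cong; subst)

  -- The vertices of T(k + 1, k): the centre, its pendant neighbour, and the inner and outer vertices of the k long legs.
  data Code (k : ℕ) : Set where
    centre tip : Code k
    mid end    : Fin k → Code k

  arc : ∀ {k} → Code k → Code k → Bool
  arc centre  tip     = true
  arc centre  (mid _) = true
  arc (mid i) (end j) = does (i Fin.≟ j)
  arc _       _       = false

  codeAdj : ∀ {k} → Code k → Code k → Bool
  codeAdj x y = arc x y ∨ arc y x

  nbrs : ∀ {k} → Code k → List (Code k)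
  nbrs {k} centre = tip ∷ map mid (allFin k)
  nbrs tip        = centre ∷ []
  nbrs (mid i)    = centre ∷ end i ∷ []
  nbrs (end i)    = mid i ∷ []

  ∈nbrs⇒codeAdj : ∀ {k} (x : Code k) {y} → y ∈ nbrs x → codeAdj x y ≡ true
  ∈nbrs⇒codeAdj centre (here refl) = refl
  ∈nbrs⇒codeAdj centre (there y∈) with ∈-map⁻ mid y∈
  ... | _ , _ , refl = refl
  ∈nbrs⇒codeAdj tip     (here refl) = refl
  ∈nbrs⇒codeAdj (mid i) (here refl) = refl
  ∈nbrs⇒codeAdj (mid i) (there (here refl)) = cong (_∨ false) (dec-true (i Fin.≟ i) refl)
  ∈nbrs⇒codeAdj (end i) (here refl) = dec-true (i Fin.≟ i) refl

  private
    does-true : ∀ {k} (i j : Fin k) → does (i Fin.≟ j) ≡ true → i ≡ j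
    does-true i j h with yes i≡j ← i Fin.≟ j = i≡j

  codeAdj⇒∈nbrs : ∀ {k} (x y : Code k) → codeAdj x y ≡ true → y ∈ nbrs x
  codeAdj⇒∈nbrs centre tip     _ = here refl
  codeAdj⇒∈nbrs centre (mid j) _ = there (∈-map⁺ mid (∈-allFin j))
  codeAdj⇒∈nbrs tip    centre  _ = here refl
  codeAdj⇒∈nbrs (mid i) centre _ = here refl
  codeAdj⇒∈nbrs (mid i) (end j) h with does-true i j (≡.trans (≡.sym (Boolₚ.∨-identityʳ _)) h)
  ... | refl = there (here refl)
  codeAdj⇒∈nbrs (end i) (mid j) h with does-true j i h
  ... | refl = here refl
  codeAdj⇒∈nbrs centre centre ()
  codeAdj⇒∈nbrs centre (end _) ()
  codeAdj⇒∈nbrs tip tip ()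
  codeAdj⇒∈nbrs tip (mid _) ()
  codeAdj⇒∈nbrs tip (end _) ()
  codeAdj⇒∈nbrs (mid _) tip ()
  codeAdj⇒∈nbrs (mid _) (mid _) ()
  codeAdj⇒∈nbrs (end _) centre ()
  codeAdj⇒∈nbrs (end _) tip ()
  codeAdj⇒∈nbrs (end _) (end _) ()

  -- An isomorphism with T(k + 1, k) in a form free of vertex numbers. Both the numbered spider and
  -- the extremal tree receive one, and eigenvectors are computed on codes, where neighbourhoods are
  -- explicit lists.
  record Coding {n : ℕ} (A : Fin n → Fin n → Bool) (k : ℕ) : Set where
    field
      encode        : Fin n → Code k
      decode        : Code k → Fin n
      decode-encode : ∀ v → decode (encode v) ≡ v
      encode-decode : ∀ x → encode (decode x) ≡ x
      adjacency     : ∀ x y → A (decode x) (decode y) ≡ codeAdj x y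

  codings⇒Iso : ∀ {n m k} {A : Fin n → Fin n → Bool} {B : Fin m → Fin m → Bool} → Coding A k → Coding B k → Iso A B
  codings⇒Iso {A = A} {B} a b = (λ v → b.decode (a.encode v)) , (λ v → a.decode (b.encode v)) ,
    (λ v → ≡.trans (cong a.decode (b.encode-decode _)) (a.decode-encode v)) ,
    (λ v → ≡.trans (cong b.decode (a.encode-decode _)) (b.decode-encode v)) ,
    λ u v → ≡.trans (≡.sym (≡.cong₂ A (a.decode-encode u) (a.decode-encode v))) (≡.trans (a.adjacency _ _) (≡.sym (b.adjacency _ _)))
    where
    module a = Coding a
    module b = Coding b

  Iso⇒coding : ∀ {n m k} {A : Fin n → Fin n → Bool} {B : Fin m → Fin m → Bool} → Iso A B → Coding B k → Coding A k
  Iso⇒coding {A = A} {B} (f , g , gf , fg , adj≡) b = record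
    { encode        = λ v → b.encode (f v)
    ; decode        = λ x → g (b.decode x)
    ; decode-encode = λ v → ≡.trans (cong g (b.decode-encode (f v))) (gf v)
    ; encode-decode = λ x → ≡.trans (cong b.encode (fg _)) (b.encode-decode x)
    ; adjacency     = λ x y → ≡.trans (adj≡ _ _) (≡.trans (≡.cong₂ B (fg _) (fg _)) (b.adjacency x y))
    }
    where module b = Coding b

  module _ (k : ℕ) where

    private
      size : suc k +ℕ k +ℕ 1 ≡ suc k +ℕ suc k
      size = ≡.trans (ℕₚ.+-comm (suc k +ℕ k) 1) (≡.sym (ℕₚ.+-suc (suc k) k))

      -- The numbering of the spider consists of two blocks of k + 1: the centre followed by the
      -- inner leg vertices, then the pendant neighbour followed by the outer ones.
      toHalves : Code k → Fin (suc k) ⊎ Fin (suc k)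
      toHalves centre  = inj₁ fzero
      toHalves (mid i) = inj₁ (fsuc i)
      toHalves tip     = inj₂ fzero
      toHalves (end i) = inj₂ (fsuc i)

      fromHalves : Fin (suc k) ⊎ Fin (suc k) → Code k
      fromHalves (inj₁ fzero)    = centre
      fromHalves (inj₁ (fsuc i)) = mid i
      fromHalves (inj₂ fzero)    = tip
      fromHalves (inj₂ (fsuc i)) = end i

      from-to : ∀ x → fromHalves (toHalves x) ≡ x
      from-to centre  = refl
      from-to tip     = refl
      from-to (mid i) = refl
      from-to (end i) = refl

      to-from : ∀ x → toHalves (fromHalves x) ≡ x
      to-from (inj₁ fzero)    = refl
      to-from (inj₁ (fsuc i)) = refl
      to-from (inj₂ fzero)    = refl
      to-from (inj₂ (fsuc i)) = refl

      encode : Fin (suc k +ℕ k +ℕ 1) → Code k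
      encode v = fromHalves (splitAt (suc k) (Fin.cast size v))

      decode : Code k → Fin (suc k +ℕ k +ℕ 1)
      decode x = Fin.cast (≡.sym size) (Fin.join (suc k) (suc k) (toHalves x))

      -- With s = k + 1, the pendant neighbour gets the number s: the only neighbour of the centre
      -- whose number exceeds k and which is therefore not extended.
      number : Code k → ℕ
      number centre  = 0
      number (mid i) = suc (toℕ i)
      number tip     = suc k
      number (end i) = suc (toℕ i) +ℕ suc k

      toℕ-decode : ∀ x → toℕ (decode x) ≡ number x
      toℕ-decode x = ≡.trans (Finₚ.toℕ-cast (≡.sym size) (Fin.join (suc k) (suc k) (toHalves x))) (lemma x)
        where
        lemma : ∀ x → toℕ (Fin.join (suc k) (suc k) (toHalves x)) ≡ number x
        lemma centre  = refl
        lemma tip     = ≡.trans (Finₚ.toℕ-↑ʳ (suc k) (fzero {k})) (ℕₚ.+-identityʳ (suc k))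
        lemma (mid i) = Finₚ.toℕ-↑ˡ (fsuc i) (suc k)
        lemma (end i) = ≡.trans (Finₚ.toℕ-↑ʳ (suc k) (fsuc i)) (ℕₚ.+-comm (suc k) (suc (toℕ i)))

      T⇒true : ∀ {b} → T b → b ≡ true
      T⇒true {true} _ = refl

      ¬T⇒false : ∀ {b} → ¬ T b → b ≡ false
      ¬T⇒false {false} _ = refl
      ¬T⇒false {true}  h = ⊥-elim (h _)

      ≤ᵇ-true : ∀ {a b} → a ≤ℕ b → (a ≤ᵇ b) ≡ true
      ≤ᵇ-true a≤b = T⇒true (ℕₚ.≤⇒≤ᵇ a≤b)

      ≤ᵇ-false : ∀ {a b} → b <ℕ a → (a ≤ᵇ b) ≡ false
      ≤ᵇ-false {a} b<a = ¬T⇒false (λ h → ℕₚ.<⇒≱ b<a (ℕₚ.≤ᵇ⇒≤ a _ h))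

      ≡ᵇ-false : ∀ {a b} → a ≢ b → (a ≡ᵇ b) ≡ false
      ≡ᵇ-false {a} {b} a≢b = ¬T⇒false (a≢b ∘ ℕₚ.≡ᵇ⇒≡ a b)

      suc+>k : ∀ (j : Fin k) → suc k <ℕ suc (toℕ j) +ℕ suc k
      suc+>k j = s≤s (ℕₚ.m≤n+m (suc k) (toℕ j))

      from-mid : ∀ (i : Fin k) b → spiderAdjℕ (suc k) k (suc (toℕ i)) b ≡ (b ≡ᵇ (suc (toℕ i) +ℕ suc k))
      from-mid i b rewrite ≤ᵇ-true (Finₚ.toℕ<n i) = refl

      number-arc : ∀ x y → spiderAdjℕ (suc k) k (number x) (number y) ≡ arc x y
      number-arc centre centre = refl
      number-arc centre tip rewrite ≤ᵇ-true (ℕₚ.≤-refl {suc k}) = refl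
      number-arc centre (mid j) rewrite ≤ᵇ-true (s≤s (ℕₚ.<⇒≤ (Finₚ.toℕ<n j))) = refl
      number-arc centre (end j) rewrite ≤ᵇ-false (suc+>k j) = refl
      number-arc (mid i) centre  = from-mid i 0
      number-arc (mid i) tip     = ≡.trans (from-mid i (suc k)) (≡ᵇ-false (ℕₚ.<⇒≢ (suc+>k i)))
      number-arc (mid i) (mid j) = ≡.trans (from-mid i (suc (toℕ j)))
        (≡ᵇ-false (ℕₚ.<⇒≢ (ℕₚ.<-trans (s≤s (Finₚ.toℕ<n j)) (suc+>k i))))
      number-arc (mid i) (end j) = ≡.trans (from-mid i (suc (toℕ j) +ℕ suc k)) (same i j)
        where
        same : ∀ (i j : Fin k) → (suc (toℕ j) +ℕ suc k ≡ᵇ suc (toℕ i) +ℕ suc k) ≡ does (i Fin.≟ j)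
        same i j with i Fin.≟ j
        ... | yes refl = T⇒true (ℕₚ.≡⇒≡ᵇ (suc (toℕ i) +ℕ suc k) _ refl)
        ... | no  i≢j  = ≡ᵇ-false λ h → i≢j (Finₚ.toℕ-injective (ℕₚ.suc-injective (≡.sym (ℕₚ.+-cancelʳ-≡ (suc k) _ _ h))))
      number-arc tip y rewrite ≤ᵇ-false (ℕₚ.n<1+n k) = lemma y
        where
        lemma : ∀ y → false ≡ arc tip y
        lemma centre  = refl
        lemma tip     = refl
        lemma (mid _) = refl
        lemma (end _) = refl
      number-arc (end i) y rewrite ≤ᵇ-false (ℕₚ.<-trans (ℕₚ.n<1+n k) (suc+>k i)) = lemma y
        where
        lemma : ∀ y → false ≡ arc (end i) y
        lemma centre  = refl
        lemma tip     = refl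
        lemma (mid _) = refl
        lemma (end _) = refl

    spider-coding : Coding (spiderAdj (suc k) k) k
    spider-coding = record
      { encode = encode
      ; decode = decode
      ; decode-encode = λ v → ≡.trans (cong (Fin.cast (≡.sym size) ∘ Fin.join (suc k) (suc k)) (to-from (splitAt (suc k) (Fin.cast size v))))
          (≡.trans (cong (Fin.cast (≡.sym size)) (Finₚ.join-splitAt (suc k) (suc k) (Fin.cast size v))) (Finₚ.cast-involutive (≡.sym size) size v))
      ; encode-decode = λ x → ≡.trans (cong (fromHalves ∘ splitAt (suc k)) (Finₚ.cast-involutive size (≡.sym size) (Fin.join (suc k) (suc k) (toHalves x))))
          (≡.trans (cong fromHalves (Finₚ.splitAt-join (suc k) (suc k) (toHalves x))) (from-to x))
      ; adjacency = λ x y → ≡.cong₂ _∨_ (same-arc x y) (same-arc y x)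
      }
      where
      same-arc : ∀ x y → spiderAdjℕ (suc k) k (toℕ (decode x)) (toℕ (decode y)) ≡ arc x y
      same-arc x y = ≡.trans (≡.cong₂ (spiderAdjℕ (suc k) k) (toℕ-decode x) (toℕ-decode y)) (number-arc x y)

  private
    shift : ∀ {k} → Code k → Code (suc k)
    shift centre  = centre
    shift tip     = tip
    shift (mid i) = mid (fsuc i)
    shift (end i) = end (fsuc i)

    legCodes : ∀ k → List (Code k)
    legCodes zero    = []
    legCodes (suc k) = mid fzero ∷ end fzero ∷ map shift (legCodes k)

    mid∈ : ∀ {k} (i : Fin k) → mid i ∈ legCodes k
    mid∈ fzero    = here refl
    mid∈ (fsuc i) = there (there (∈-map⁺ shift (mid∈ i)))

    end∈ : ∀ {k} (i : Fin k) → end i ∈ legCodes k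
    end∈ fzero    = there (here refl)
    end∈ (fsuc i) = there (there (∈-map⁺ shift (end∈ i)))

  allCodes : ∀ k → List (Code k)
  allCodes k = centre ∷ tip ∷ legCodes k

  ∈allCodes : ∀ {k} (x : Code k) → x ∈ allCodes k
  ∈allCodes centre  = here refl
  ∈allCodes tip     = there (here refl)
  ∈allCodes (mid i) = there (there (mid∈ i))
  ∈allCodes (end i) = there (there (end∈ i))

  module _ {A : Set} where

    private
      flatten : List (A × A) → List A
      flatten []            = []
      flatten ((z , w) ∷ L) = z ∷ w ∷ flatten L

      legs : ∀ {ts : List (Rose A)} → All Leg ts → List (A × A)
      legs []                  = []
      legs (leg {z} {w} ∷ lgs) = (z , w) ∷ legs lgs

      legs-verts : ∀ {ts : List (Rose A)} (lgs : All Leg ts) → vertsF ts ≡ flatten (legs lgs)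
      legs-verts []          = refl
      legs-verts (leg ∷ lgs) = cong (λ l → _ ∷ _ ∷ l) (legs-verts lgs)

    pendantOf : ∀ {ts : List (Rose A)} → LegsLeaf ts → A
    pendantOf (here (leaf {v}) _) = v
    pendantOf (there _ ll)        = pendantOf ll

    legsOf : ∀ {ts : List (Rose A)} → LegsLeaf ts → List (A × A)
    legsOf (here _ lgs)           = legs lgs
    legsOf (there (leg {z} {w}) ll) = (z , w) ∷ legsOf ll

    decodeWith : A → A → (L : List (A × A)) → Code (length L) → A
    decodeWith r p L centre  = r
    decodeWith r p L tip     = p
    decodeWith r p L (mid i) = proj₁ (lookup L i)
    decodeWith r p L (end i) = proj₂ (lookup L i)

    private
      LegsLeaf-verts : ∀ {ts : List (Rose A)} (ll : LegsLeaf ts) → vertsF ts ↭ pendantOf ll ∷ flatten (legsOf ll)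
      LegsLeaf-verts (here leaf lgs) rewrite legs-verts lgs = ↭-refl
      LegsLeaf-verts (there leg ll) = ↭-trans (prep _ (prep _ (LegsLeaf-verts ll)))
        (↭-trans (prep _ (swap _ _ ↭-refl)) (swap _ _ ↭-refl))

      decode-legCodes : ∀ r p L → map (decodeWith r p L) (legCodes (length L)) ≡ flatten L
      decode-legCodes r p []            = refl
      decode-legCodes r p ((z , w) ∷ L) = cong (λ l → z ∷ w ∷ l) (≡.trans
        (≡.trans (≡.sym (Listₚ.map-∘ (legCodes (length L)))) (Listₚ.map-cong decode-shift (legCodes (length L))))
        (decode-legCodes r p L))
        where
        decode-shift : ∀ x → decodeWith r p ((z , w) ∷ L) (shift x) ≡ decodeWith r p L x
        decode-shift centre  = refl
        decode-shift tip     = refl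
        decode-shift (mid i) = refl
        decode-shift (end i) = refl

    -- The preorder listing differs from the codes only in the place of the pendant leaf. Through
    -- this permutation, distinctness of the tree's vertices makes decoding injective, and the
    -- covering of the graph makes it surjective.
    verts-codes : ∀ r {ts : List (Rose A)} (ll : LegsLeaf ts) →
      r ∷ vertsF ts ↭ map (decodeWith r (pendantOf ll) (legsOf ll)) (allCodes (length (legsOf ll)))
    verts-codes r ll = prep r (↭-trans (LegsLeaf-verts ll)
      (prep _ (↭-reflexive (≡.sym (decode-legCodes r (pendantOf ll) (legsOf ll))))))

    LegsLeaf-size : ∀ {ts : List (Rose A)} (ll : LegsLeaf ts) → length (vertsF ts) ≡ suc (2 *ℕ length (legsOf ll))
    LegsLeaf-size (here leaf lgs) = cong suc (size lgs)
      where
      size : ∀ {ts : List (Rose A)} (lgs : All Leg ts) → length (vertsF ts) ≡ 2 *ℕ length (legs lgs)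
      size []          = refl
      size (leg ∷ lgs) = ≡.trans (cong (2 +ℕ_) (size lgs)) (arith (length (legs lgs)))
        where
        arith : ∀ k → 2 +ℕ 2 *ℕ k ≡ 2 *ℕ suc k
        arith = solve-∀
    LegsLeaf-size (there leg ll) = ≡.trans (cong (2 +ℕ_) (LegsLeaf-size ll)) (arith (length (legsOf ll)))
      where
      arith : ∀ k → 2 +ℕ suc (2 *ℕ k) ≡ suc (2 *ℕ suc k)
      arith = solve-∀

    LegsLeaf-roots : ∀ {ts : List (Rose A)} (ll : LegsLeaf ts) {v} → v ∈ map root ts →
      v ≡ pendantOf ll ⊎ ∃ λ i → v ≡ proj₁ (lookup (legsOf ll) i)
    LegsLeaf-roots (here leaf lgs) (here eq)  = inj₁ eq
    LegsLeaf-roots (here leaf lgs) (there v∈) = inj₂ (go lgs v∈)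
      where
      go : ∀ {ts : List (Rose A)} (lgs : All Leg ts) {v} → v ∈ map root ts → ∃ λ i → v ≡ proj₁ (lookup (legs lgs) i)
      go (leg ∷ lgs) (here eq) = fzero , eq
      go (leg ∷ lgs) (there v∈) with go lgs v∈
      ... | i , eq = fsuc i , eq
    LegsLeaf-roots (there leg ll) (here eq) = inj₂ (fzero , eq)
    LegsLeaf-roots (there leg ll) (there v∈) with LegsLeaf-roots ll v∈
    ... | inj₁ eq       = inj₁ eq
    ... | inj₂ (i , eq) = inj₂ (fsuc i , eq)

    LegsLeaf-pendant : ∀ {ts : List (Rose A)} (ll : LegsLeaf ts) → node (pendantOf ll) [] ∈ ts
    LegsLeaf-pendant (here leaf _) = here refl
    LegsLeaf-pendant (there _ ll)  = there (LegsLeaf-pendant ll)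

    LegsLeaf-leg : ∀ {ts : List (Rose A)} (ll : LegsLeaf ts) i →
      let (z , w) = lookup (legsOf ll) i in node z (node w [] ∷ []) ∈ ts
    LegsLeaf-leg (here leaf lgs) i = there (go lgs i)
      where
      go : ∀ {ts : List (Rose A)} (lgs : All Leg ts) i → let (z , w) = lookup (legs lgs) i in node z (node w [] ∷ []) ∈ ts
      go (leg ∷ lgs) fzero    = here refl
      go (leg ∷ lgs) (fsuc i) = there (go lgs i)
    LegsLeaf-leg (there leg ll) fzero    = here refl
    LegsLeaf-leg (there leg ll) (fsuc i) = there (LegsLeaf-leg ll i)

  map-unique⇒injective : ∀ {A B : Set} {f : A → B} {l} → Unique (map f l) → ∀ {x y} → x ∈ l → y ∈ l → f x ≡ f y → x ≡ y
  map-unique⇒injective (_ ∷ _)  (here refl) (here refl) _  = refl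
  map-unique⇒injective {f = f} {l = _ ∷ l} (p ∷ _) (here refl) (there y∈) eq = ⊥-elim (All≢⇒∉ p (subst (_∈ map f l) (≡.sym eq) (∈-map⁺ f y∈)))
  map-unique⇒injective {f = f} {l = _ ∷ l} (p ∷ _) (there x∈) (here refl) eq = ⊥-elim (All≢⇒∉ p (subst (_∈ map f l) eq (∈-map⁺ f x∈)))
  map-unique⇒injective (_ ∷ ps) (there x∈) (there y∈) eq = map-unique⇒injective ps x∈ y∈ eq

  module _ {n} {G : Graph n} (tree : IsTree G) {r ts} (rep : Rep G [] (node r ts)) (ll : LegsLeaf ts) where

    private
      L = legsOf ll
      k = length L

      dec : Code k → Fin n
      dec = decodeWith r (pendantOf ll) L

      perm : verts (node r ts) ↭ map dec (allCodes k)
      perm = verts-codes r ll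

      injective : ∀ x y → dec x ≡ dec y → x ≡ y
      injective x y = map-unique⇒injective (PermS.Unique-resp-↭ (≡.setoid _) (↭⇒↭ₛ perm) (verts-unique G (proj₂ tree) rep)) (∈allCodes x) (∈allCodes y)

      surjective : ∀ v → ∃ λ x → x ∈ allCodes k × v ≡ dec x
      surjective v = ∈-map⁻ dec (Perm.∈-resp-↭ perm (covers G (proj₁ tree) rep v))

      enc : Fin n → Code k
      enc v = proj₁ (surjective v)

      dec-enc : ∀ v → dec (enc v) ≡ v
      dec-enc v = ≡.sym (proj₂ (proj₂ (surjective v)))

      leafRep : Rep G (r ∷ []) (node (pendantOf ll) [])
      leafRep = All.lookup (children rep) (LegsLeaf-pendant ll)

      midRep : ∀ i → let (z , w) = lookup L i in Rep G (r ∷ []) (node z (node w [] ∷ []))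
      midRep i = All.lookup (children rep) (LegsLeaf-leg ll i)

      endRep : ∀ i → let (z , w) = lookup L i in Rep G (z ∷ []) (node w [])
      endRep i = All.head (children (midRep i))

      nbrs⁺ : ∀ x {y} → y ∈ nbrs x → _~_ G (dec x) (dec y)
      nbrs⁺ centre (here refl) = ~-sym G (nbrs-adjacent leafRep (here refl))
      nbrs⁺ centre (there y∈) with ∈-map⁻ mid y∈
      ... | i , _ , refl = ~-sym G (nbrs-adjacent (midRep i) (here refl))
      nbrs⁺ tip (here refl) = nbrs-adjacent leafRep (here refl)
      nbrs⁺ (mid i) (here refl) = nbrs-adjacent (midRep i) (here refl)
      nbrs⁺ (mid i) (there (here refl)) = nbrs-adjacent (midRep i) (there (here refl))
      nbrs⁺ (end i) (here refl) = nbrs-adjacent (endRep i) (here refl)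

      nbrs⁻ : ∀ x {v} → _~_ G (dec x) v → ∃ λ y → y ∈ nbrs x × v ≡ dec y
      nbrs⁻ centre x~v with LegsLeaf-roots ll (nbrs-complete rep _ x~v)
      ... | inj₁ eq       = tip , here refl , eq
      ... | inj₂ (i , eq) = mid i , there (∈-map⁺ mid (∈-allFin i)) , eq
      nbrs⁻ tip x~v with nbrs-complete leafRep _ x~v
      ... | here eq = centre , here refl , eq
      nbrs⁻ (mid i) x~v with nbrs-complete (midRep i) _ x~v
      ... | here eq         = centre , here refl , eq
      ... | there (here eq) = end i , there (here refl) , eq
      nbrs⁻ (end i) x~v with nbrs-complete (endRep i) _ x~v
      ... | here eq = mid i , here refl , eq

      Bool-ext : ∀ {a b} → (a ≡ true → b ≡ true) → (b ≡ true → a ≡ true) → a ≡ b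
      Bool-ext {true}  {true}  _ _ = refl
      Bool-ext {false} {false} _ _ = refl
      Bool-ext {true}  {false} f _ with () ← f refl
      Bool-ext {false} {true}  _ g with () ← g refl

    spider⇒coding : Coding (adj G) k
    spider⇒coding = record
      { encode = enc
      ; decode = dec
      ; decode-encode = dec-enc
      ; encode-decode = λ x → injective _ x (dec-enc (dec x))
      ; adjacency = λ x y → Bool-ext (to x y) (λ h → nbrs⁺ x (codeAdj⇒∈nbrs x y h))
      }
      where
      to : ∀ x y → _~_ G (dec x) (dec y) → codeAdj x y ≡ true
      to x y x~y with nbrs⁻ x x~y
      ... | y′ , y′∈ , eq with refl ← injective y y′ eq = ∈nbrs⇒codeAdj x y′∈

    spider-order : n ≡ 2 *ℕ suc k
    spider-order = ≡.trans (≡.sym (verts-length G tree rep)) (≡.trans (cong suc (LegsLeaf-size ll)) (arith k))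
      where
      arith : ∀ k → suc (suc (2 *ℕ k)) ≡ 2 *ℕ suc k
      arith = solve-∀

open Codings

-- Eigenvectors of spiders

mid-injective : ∀ {k} {i j : Fin k} → mid i ≡ mid j → i ≡ j
mid-injective ≡.refl = ≡.refl

nbrs-code-unique : ∀ {k} (x : Code k) → Unique (nbrs x)
nbrs-code-unique {k} centre = ∉⇒All≢ tip∉ ∷ Uniqueₚ.map⁺ mid-injective (Uniqueₚ.allFin⁺ k)
  where
  tip∉ : tip ∉ map mid (allFin k)
  tip∉ t∈ with ∈-map⁻ mid t∈
  ... | _ , _ , ()
nbrs-code-unique tip     = [] ∷ []
nbrs-code-unique (mid i) = ((λ ()) ∷ []) ∷ [] ∷ []
nbrs-code-unique (end i) = [] ∷ []

module SpiderSpectrum {c ℓ} (F : OrderedField c ℓ) {n k} {G : Graph n} (coding : Coding (adj G) k) where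
  open FieldKit F
  open LinAlg F
  open Coding coding
  open import Relation.Binary.Reasoning.Setoid setoid

  CodeEig : Carrier → (Code k → Carrier) → Set ℓ
  CodeEig μ X = ∀ x → ι (length (nbrs x)) * X x - sumOver X (nbrs x) ≈ μ * X x

  private
    sumOver-map : ∀ {A B : Set} (X : B → Carrier) (f : A → B) l → sumOver X (map f l) ≡ sumOver (X ∘ f) l
    sumOver-map X f []      = ≡.refl
    sumOver-map X f (v ∷ l) = ≡.cong (X (f v) +_) (sumOver-map X f l)

    sumOver-cong : ∀ {A : Set} {X Y : A → Carrier} → (∀ v → X v ≈ Y v) → ∀ l → sumOver X l ≈ sumOver Y l
    sumOver-cong h []      = refl
    sumOver-cong h (v ∷ l) = +-cong (h v) (sumOver-cong h l)

    sumOver-tabulate : ∀ {A : Set} {m} (X : A → Carrier) (f : Fin m → A) → sumOver X (tabulate f) ≡ ∑ (X ∘ f)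
    sumOver-tabulate {m = zero}  X f = ≡.refl
    sumOver-tabulate {m = suc m} X f = ≡.cong (X (f fzero) +_) (sumOver-tabulate X (f ∘ fsuc))

  sumOver-mids : ∀ X → sumOver X (map mid (allFin k)) ≡ ∑ (X ∘ mid)
  sumOver-mids X = ≡.trans (sumOver-map X mid (allFin k)) (sumOver-tabulate (X ∘ mid) id)

  laplacian-code : ∀ x y → laplacianApply F G x (decode y) ≈ ι (length (nbrs y)) * x (decode y) - sumOver (x ∘ decode) (nbrs y)
  laplacian-code x y = trans
    (laplacian-local G x (decode y) (Uniqueₚ.map⁺ decode-injective (nbrs-code-unique y)) to from)
    (+-cong (*-congʳ (reflexive (≡.cong ι (Listₚ.length-map decode (nbrs y))))) (-‿cong (reflexive (sumOver-map x decode (nbrs y)))))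
    where
    decode-injective : ∀ {u v} → decode u ≡ decode v → u ≡ v
    decode-injective {u} {v} eq = ≡.trans (≡.sym (encode-decode u)) (≡.trans (≡.cong encode eq) (encode-decode v))
    to : ∀ j → adj G (decode y) j ≡ true → j ∈ map decode (nbrs y)
    to j h = ≡.subst (_∈ map decode (nbrs y)) (decode-encode j) (∈-map⁺ decode (codeAdj⇒∈nbrs y (encode j)
      (≡.trans (≡.sym (adjacency y (encode j))) (≡.trans (≡.cong (adj G (decode y)) (decode-encode j)) h))))
    from : ∀ {j} → j ∈ map decode (nbrs y) → adj G (decode y) j ≡ true
    from j∈ with ∈-map⁻ decode j∈
    ... | z , z∈ , ≡.refl = ≡.trans (adjacency y z) (∈nbrs⇒codeAdj y z∈)

  eigenvector⇒code : ∀ {μ x} → IsLapEigenvector F G μ x → CodeEig μ (x ∘ decode)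
  eigenvector⇒code {x = x} eig y = trans (sym (laplacian-code x y)) (eig (decode y))

  code⇒eigenvector : ∀ {μ X} → CodeEig μ X → IsLapEigenvector F G μ (X ∘ encode)
  code⇒eigenvector {μ} {X} eig v = ≡.subst (λ v → laplacianApply F G (X ∘ encode) v ≈ μ * X (encode v)) (decode-encode v) (begin
    laplacianApply F G (X ∘ encode) (decode y)
      ≈⟨ laplacian-code (X ∘ encode) y ⟩
    ι (length (nbrs y)) * X (encode (decode y)) - sumOver (X ∘ encode ∘ decode) (nbrs y)
      ≈⟨ +-cong (*-congˡ (back y)) (-‿cong (sumOver-cong back (nbrs y))) ⟩
    ι (length (nbrs y)) * X y - sumOver X (nbrs y)
      ≈⟨ eig y ⟩
    μ * X y
      ≈⟨ *-congˡ (back y) ⟨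
    μ * X (encode (decode y)) ∎)
    where
    y = encode v
    back : ∀ z → X (encode (decode z)) ≈ X z
    back z = reflexive (≡.cong X (encode-decode z))

  vanish : ∀ {x : Fin n → Carrier} → (∀ y → x (decode y) ≈ 0#) → ∀ v → x v ≈ 0#
  vanish {x} h v = ≡.subst (λ v → x v ≈ 0#) (decode-encode v) (h (encode v))

  module _ {μ X} (eig : CodeEig μ X) where

    tip-equation : (ι 1 - μ) * X tip ≈ X centre
    tip-equation = by-eq (ι 1) (eig tip) (solve 3 (λ m x p →
      (con (ℤ.+ 1) :- m) :* x := p :+ con (ℤ.+ 1) :* ((con (ℤ.+ 1) :* x :- (p :+ con (ℤ.+ 0))) :- m :* x))
      refl μ (X tip) (X centre))

    end-equation : ∀ i → (ι 1 - μ) * X (end i) ≈ X (mid i)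
    end-equation i = by-eq (ι 1) (eig (end i)) (solve 3 (λ m x p →
      (con (ℤ.+ 1) :- m) :* x := p :+ con (ℤ.+ 1) :* ((con (ℤ.+ 1) :* x :- (p :+ con (ℤ.+ 0))) :- m :* x))
      refl μ (X (end i)) (X (mid i)))

    mid-equation : ∀ i → (ι 2 - μ) * X (mid i) ≈ X centre + X (end i)
    mid-equation i = by-eq (ι 1) (eig (mid i)) (solve 4 (λ m x p w →
      (con (ℤ.+ 2) :- m) :* x := (p :+ w) :+ con (ℤ.+ 1) :* ((con (ℤ.+ 2) :* x :- (p :+ (w :+ con (ℤ.+ 0)))) :- m :* x))
      refl μ (X (mid i)) (X centre) (X (end i)))

    centre-equation : (ι (length (nbrs {k} centre)) - μ) * X centre ≈ X tip + ∑ (X ∘ mid)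
    centre-equation = trans (by-eq (ι 1) (eig centre) (solve 4 (λ d m p s →
      (d :- m) :* p := s :+ con (ℤ.+ 1) :* ((d :* p :- s) :- m :* p))
      refl (ι (length (nbrs {k} centre))) μ (X centre) (sumOver X (nbrs centre)))) (+-congˡ (reflexive (sumOver-mids X)))

module SpiderMultiplicity {c ℓ} (F : OrderedField c ℓ) {n k} {G : Graph n} (coding : Coding (adj G) (suc (suc k)))
  {μ : OrderedField.Carrier F} (μ≉1 : ¬ (OrderedField._≈_ F μ (OrderedField.1# F))) where
  open FieldKit F
  open LinAlg F
  open Elimination F μ μ≉1 {Fin n} using (Q; δ; δ≉0)
  open Coding coding
  open SpiderSpectrum F {G = G} coding
  open import Relation.Binary.Reasoning.Setoid setoid

  private
    δ′ : ι 1 - μ ≈ δ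
    δ′ = +-congʳ (+-identityʳ 1#)

  -- Fixing x at all inner leg vertices but one: the centre vanishes by the equations along any leg, the last leg by the equation at the centre.
  forcing-set : List (Fin n)
  forcing-set = map (λ i → decode (mid (fsuc i))) (allFin (suc k))

  forcing-set-forces : Forces (IsLapEigenvector F G μ) forcing-set
  forcing-set-forces {x} eig′ zs = vanish zero-at
    where
    X = x ∘ decode
    eig : CodeEig μ X
    eig = eigenvector⇒code eig′
    mids : ∀ i → X (mid (fsuc i)) ≈ 0#
    mids i = All.lookup zs (∈-map⁺ (λ i → decode (mid (fsuc i))) (∈-allFin i))
    end≈0 : ∀ i → X (mid i) ≈ 0# → X (end i) ≈ 0#
    end≈0 i h = *-cancel-0 δ≉0 (trans (*-congʳ (sym δ′)) (trans (end-equation eig i) h))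
    ends : ∀ i → X (end (fsuc i)) ≈ 0#
    ends i = end≈0 (fsuc i) (mids i)
    centre≈0 : X centre ≈ 0#
    centre≈0 = begin
      X centre                         ≈⟨ +-identityʳ _ ⟨
      X centre + 0#                    ≈⟨ +-congˡ (ends fzero) ⟨
      X centre + X (end (fsuc fzero))  ≈⟨ mid-equation eig (fsuc fzero) ⟨
      (ι 2 - μ) * X (mid (fsuc fzero)) ≈⟨ trans (*-congˡ (mids fzero)) (zeroʳ _) ⟩
      0# ∎
    tip≈0 : X tip ≈ 0#
    tip≈0 = *-cancel-0 δ≉0 (trans (*-congʳ (sym δ′)) (trans (tip-equation eig) centre≈0))
    mid₀≈0 : X (mid fzero) ≈ 0#
    mid₀≈0 = begin
      X (mid fzero)                           ≈⟨ +-identityʳ _ ⟨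
      X (mid fzero) + 0#                      ≈⟨ +-congˡ (∑-zero mids) ⟨
      ∑ (X ∘ mid)                             ≈⟨ +-identityˡ _ ⟨
      0# + ∑ (X ∘ mid)                        ≈⟨ +-congʳ tip≈0 ⟨
      X tip + ∑ (X ∘ mid)                     ≈⟨ centre-equation eig ⟨
      (ι (length (nbrs {suc (suc k)} centre)) - μ) * X centre ≈⟨ trans (*-congˡ centre≈0) (zeroʳ _) ⟩
      0# ∎
    zero-at : ∀ y → X y ≈ 0#
    zero-at centre         = centre≈0
    zero-at tip            = tip≈0
    zero-at (mid fzero)    = mid₀≈0
    zero-at (mid (fsuc i)) = mids i
    zero-at (end fzero)    = end≈0 fzero mid₀≈0
    zero-at (end (fsuc i)) = ends i

  multiplicity-≤ : ∀ {m} → HasIndepEigenvectors F G μ m → m ≤ℕ suc k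
  multiplicity-≤ {m} vecs = ≡.subst (m ≤ℕ_)
    (≡.trans (Listₚ.length-map _ (allFin (suc k))) (Listₚ.length-tabulate {n = suc k} id))
    (multiplicity≤ G μ vecs forcing-set-forces)

  module _ (hQ : Q) where

    private
      -- Leg `fzero` is compared with leg `fsuc i`: the coefficients -1 and 1 cancel in the equation
      -- at the centre.
      coefficient : Fin (suc k) → Fin (suc (suc k)) → Carrier
      coefficient i fzero    = - 1#
      coefficient i (fsuc j) = if does (j Fin.≟ i) then 1# else 0#

      coefficient-off : ∀ i j → j ≢ i → coefficient i (fsuc j) ≈ 0#
      coefficient-off i j j≢i = reflexive (≡.cong (λ b → if b then 1# else 0#) (dec-false (j Fin.≟ i) j≢i))

      coefficient-on : ∀ i → coefficient i (fsuc i) ≈ 1#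
      coefficient-on i = reflexive (≡.cong (λ b → if b then 1# else 0#) (dec-true (i Fin.≟ i) ≡.refl))

      coefficient-sum : ∀ i → ∑ (coefficient i) ≈ 0#
      coefficient-sum i = begin
        - 1# + ∑ (coefficient i ∘ fsuc)  ≈⟨ +-congˡ (∑-split i {g = λ _ → 0#} (coefficient-off i) refl) ⟩
        - 1# + (coefficient i (fsuc i) + ∑ {suc k} (λ _ → 0#)) ≈⟨ +-congˡ (+-cong (coefficient-on i) (∑-zero {suc k} λ _ → refl)) ⟩
        - 1# + (1# + 0#)                 ≈⟨ trans (+-congˡ (+-identityʳ 1#)) (-‿inverseˡ 1#) ⟩
        0# ∎

      -- On each leg the ratio of inner to outer value is 1 - μ by the equation at the outer vertex.
      -- With the centre at 0, the inner equation becomes (2 - μ)(1 - μ) = 1, which is `Q`.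
      vector : Fin (suc k) → Code (suc (suc k)) → Carrier
      vector i centre  = 0#
      vector i tip     = 0#
      vector i (mid j) = δ * coefficient i j
      vector i (end j) = coefficient i j

      vector-eig : ∀ i → CodeEig μ (vector i)
      vector-eig i centre = begin
        d * 0# - (0# + sumOver (vector i) (map mid (allFin (suc (suc k))))) ≈⟨ +-congˡ (-‿cong (+-congˡ (reflexive (sumOver-mids (vector i))))) ⟩
        d * 0# - (0# + ∑ (λ j → δ * coefficient i j))                       ≈⟨ +-congˡ (-‿cong sum≈0) ⟩
        d * 0# - 0#  ≈⟨ solve 2 (λ d m → d :* con (ℤ.+ 0) :- con (ℤ.+ 0) := m :* con (ℤ.+ 0)) refl d μ ⟩
        μ * 0# ∎
        where
        d = ι (length (nbrs {suc (suc k)} centre))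
        sum≈0 : 0# + ∑ (λ j → δ * coefficient i j) ≈ 0#
        sum≈0 = begin
          0# + ∑ (λ j → δ * coefficient i j)                         ≈⟨ +-congʳ (∑-zero {suc (suc k)} (λ _ → refl)) ⟨
          ∑ {suc (suc k)} (λ _ → 0#) + ∑ (λ j → δ * coefficient i j) ≈⟨ +-congˡ (trans (∑-cong {f = λ j → δ * coefficient i j} (λ j → sym (+-identityˡ _))) (∑-linear δ (λ _ → 0#) (coefficient i))) ⟩
          ∑ {suc (suc k)} (λ _ → 0#) + (∑ {suc (suc k)} (λ _ → 0#) + δ * ∑ (coefficient i)) ≈⟨ +-cong z (+-cong z (trans (*-congˡ (coefficient-sum i)) (zeroʳ δ))) ⟩
          0# + (0# + 0#) ≈⟨ trans (+-identityˡ _) (+-identityˡ _) ⟩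
          0# ∎
          where
          z : ∑ {suc (suc k)} (λ _ → 0#) ≈ 0#
          z = ∑-zero {suc (suc k)} λ _ → refl
      vector-eig i tip = solve 1 (λ m → con (ℤ.+ 1) :* con (ℤ.+ 0) :- (con (ℤ.+ 0) :+ con (ℤ.+ 0)) := m :* con (ℤ.+ 0)) refl μ
      vector-eig i (mid j) = by-eq y hQ (by-eq (y - μ * y) (sym ι1≈1) (solve 3 (λ m y o →
        con (ℤ.+ 2) :* ((o :- m) :* y) :- (con (ℤ.+ 0) :+ (y :+ con (ℤ.+ 0))) :=
          (m :* ((o :- m) :* y) :+ y :* (((m :* m :- con (ℤ.+ 3) :* m) :+ o) :- con (ℤ.+ 0))) :+ (y :- m :* y) :* (o :- con (ℤ.+ 1)))
        refl μ y 1#))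
        where y = coefficient i j
      vector-eig i (end j) = by-eq y ι1≈1 (solve 3 (λ m y o →
        con (ℤ.+ 1) :* y :- ((o :- m) :* y :+ con (ℤ.+ 0)) := m :* y :+ y :* (con (ℤ.+ 1) :- o)) refl μ y 1#)
        where y = coefficient i j

    independent-eigenvectors : HasIndepEigenvectors F G μ (suc k)
    independent-eigenvectors = (λ i → vector i ∘ encode) , (λ i → code⇒eigenvector (vector-eig i)) , ind
      where
      -- At the outer vertex of leg `fsuc j` only the vector `j` is nonzero, so a relation evaluated
      -- there reads off its coefficient.
      ind : LinIndep F (λ i → vector i ∘ encode)
      ind a h j = begin
        a j                                                       ≈⟨ trans (+-identityʳ _) (*-identityʳ _) ⟨
        a j * 1# + 0#                                             ≈⟨ +-cong (*-congˡ (coefficient-on j)) (∑-zero {suc k} {λ _ → 0#} λ _ → refl) ⟨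
        a j * coefficient j (fsuc j) + ∑ {suc k} (λ _ → 0#)       ≈⟨ ∑-split j {λ i → a i * coefficient i (fsuc j)} {λ _ → 0#}
                                                                       (λ i i≢j → trans (*-congˡ (coefficient-off i j (i≢j ∘ ≡.sym))) (zeroʳ _)) refl ⟨
        ∑ (λ i → a i * coefficient i (fsuc j))                    ≈⟨ ∑-cong (λ i → *-congˡ {a i} (reflexive (≡.cong (vector i) (≡.sym (encode-decode (end (fsuc j))))))) ⟩
        ∑ (λ i → a i * vector i (encode (decode (end (fsuc j))))) ≈⟨ h (decode (end (fsuc j))) ⟩
        0# ∎

-- Algebraic connectivity of spiders

module Order {c ℓ} (F : OrderedField c ℓ) where
  open FieldKit F

  <-asym : ∀ {x y} → x < y → ¬ y < x
  <-asym x<y y<x = <-irrefl _ (<-trans x<y y<x)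

  <⇒≉ : ∀ {x y} → x < y → ¬ x ≈ y
  <⇒≉ {y = y} x<y x≈y = <-irrefl y (<-resp-≈ x≈y refl x<y)

  0<-resp : ∀ {x y} → x ≈ y → 0# < x → 0# < y
  0<-resp = <-resp-≈ refl

  <⇒0<- : ∀ {x y} → x < y → 0# < (y - x)
  <⇒0<- {x} x<y = <-resp-≈ (-‿inverseʳ x) refl (+-mono-< (- x) x<y)

  0<-⇒< : ∀ {x y} → 0# < (y - x) → x < y
  0<-⇒< {x} {y} h = <-resp-≈ (+-identityˡ x) (solve 2 (λ x y → (y :- x) :+ x := y) refl x y) (+-mono-< x h)

  neg-pos : ∀ {x} → x < 0# → 0# < (- x)
  neg-pos h = 0<-resp (+-identityˡ _) (<⇒0<- h)

  +-pos : ∀ {x y} → 0# < x → 0# < y → 0# < (x + y)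
  +-pos {x} {y} 0<x 0<y = <-trans 0<y (<-resp-≈ (+-identityˡ y) refl (+-mono-< y 0<x))

  0<1 : 0# < 1#
  0<1 with <-trichot 0# 1#
  ... | inj₁ h        = h
  ... | inj₂ (inj₁ h) = ⊥-elim (0≉1 h)
  ... | inj₂ (inj₂ h) = 0<-resp (trans (solve 1 (λ o → (:- o) :* (:- o) := o :* o) refl 1#) (*-identityˡ 1#)) (*-pos (neg-pos h) (neg-pos h))

  *-pos-cancel : ∀ {x y} → 0# < x → 0# < (x * y) → 0# < y
  *-pos-cancel {x} {y} 0<x 0<xy with <-trichot 0# y
  ... | inj₁ h        = h
  ... | inj₂ (inj₁ h) = ⊥-elim (<⇒≉ 0<xy (sym (trans (*-congˡ (sym h)) (zeroʳ x))))
  ... | inj₂ (inj₂ h) = ⊥-elim (<-irrefl 0# (0<-resp (solve 2 (λ x y → x :* y :+ x :* (:- y) := con (ℤ.+ 0)) refl x y) (+-pos 0<xy (*-pos 0<x (neg-pos h)))))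

  q : Carrier → Carrier
  q ν = (ν * ν - ι 3 * ν) + 1#

  q-cong : ∀ {x y} → x ≈ y → q x ≈ q y
  q-cong h = +-congʳ (+-cong (*-cong h h) (-‿cong (*-congˡ h)))

  -- The value is -1. Hence neither root of `q` is 1, and 1 cannot lie below the smaller root, where
  -- `q` is positive.
  q1<0 : (q 1#) < 0#
  q1<0 = 0<-⇒< (0<-resp (by-eq 1# (sym ι1≈1) (solve 1 (λ o →
    o := (con (ℤ.+ 0) :- ((o :* o :- con (ℤ.+ 3) :* o) :+ o)) :+ o :* (o :- con (ℤ.+ 1))) refl 1#)) 0<1)

  -- The roots of q are a and 3 − a, so q ν = (a − ν)((3 − a) − ν).
  q-factor : ∀ {a} → q a ≈ 0# → ∀ ν → q ν ≈ (a - ν) * ((ι 3 - a) - ν)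
  q-factor {a} qa ν = by-eq (ι 1) qa (solve 3 (λ a v o → (v :* v :- con (ℤ.+ 3) :* v) :+ o :=
    (a :- v) :* ((con (ℤ.+ 3) :- a) :- v) :+ con (ℤ.+ 1) :* (((a :* a :- con (ℤ.+ 3) :* a) :+ o) :- con (ℤ.+ 0))) refl a ν 1#)

  q-conjugate : ∀ {a} → q a ≈ 0# → q (ι 3 - a) ≈ 0#
  q-conjugate {a} qa = trans (q-factor qa (ι 3 - a)) (trans (*-congˡ (-‿inverseʳ _)) (zeroʳ _))

  module SmallerRoot {a} (qa : q a ≈ 0#) (a≤ : ¬ ((ι 3 - a) < a)) where

    below-conjugate : ∀ {ν} → ν < a → ν < (ι 3 - a)
    below-conjugate {ν} ν<a with <-trichot a (ι 3 - a)
    ... | inj₁ h        = <-trans ν<a h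
    ... | inj₂ (inj₁ h) = <-resp-≈ refl h ν<a
    ... | inj₂ (inj₂ h) = ⊥-elim (a≤ h)

    q-pos : ∀ {ν} → ν < a → 0# < (q ν)
    q-pos {ν} ν<a = 0<-resp (sym (q-factor qa ν)) (*-pos (<⇒0<- ν<a) (<⇒0<- (below-conjugate ν<a)))

    below-1 : ∀ {ν} → ν < a → ν < 1#
    below-1 {ν} ν<a with <-trichot ν 1#
    ... | inj₁ h        = h
    ... | inj₂ (inj₁ h) = ⊥-elim (<-asym q1<0 (q-pos (<-resp-≈ h refl ν<a)))
    ... | inj₂ (inj₂ h) = ⊥-elim (<-asym q1<0 (q-pos (<-trans h ν<a)))

    -- For negative a every term of a² + 3(-a) + 1 is positive, and at 0 the value is 1.
    0<root : 0# < a
    0<root with <-trichot 0# a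
    ... | inj₁ h        = h
    ... | inj₂ (inj₁ h) = ⊥-elim (0≉1 (trans (sym qa) (trans (q-cong (sym h)) (solve 1 (λ o → (con (ℤ.+ 0) :* con (ℤ.+ 0) :- con (ℤ.+ 3) :* con (ℤ.+ 0)) :+ o := o) refl 1#))))
    ... | inj₂ (inj₂ h) = ⊥-elim (<⇒≉ (+-pos (+-pos (*-pos (neg-pos h) (neg-pos h)) (*-pos 0<3 (neg-pos h))) 0<1)
      (sym (trans (solve 2 (λ a o → ((:- a) :* (:- a) :+ con (ℤ.+ 3) :* (:- a)) :+ o := (a :* a :- con (ℤ.+ 3) :* a) :+ o) refl a 1#) qa)))
      where
      0<3 : 0# < (ι 3)
      0<3 = +-pos 0<1 (+-pos 0<1 (0<-resp (sym (+-identityʳ 1#)) 0<1))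

module SpiderConnectivity {c ℓ} (F : OrderedField c ℓ) {n k} {G : Graph n} (coding : Coding (adj G) k) where
  open FieldKit F
  open LinAlg F
  open Order F
  open Coding coding
  open SpiderSpectrum F {G = G} coding
  open import Relation.Binary.Reasoning.Setoid setoid

  private
    -- With p the value at the centre and l its neighbours, this is the Laplacian at the centre with
    -- reversed sign.
    excess : ∀ {A : Set} (X : A → Carrier) → Carrier → List A → Carrier
    excess X p l = sumOver X l - ι (length l) * p

    excess-∷ : ∀ {A : Set} (X : A → Carrier) p v l → (X v - p) + excess X p l ≈ excess X p (v ∷ l)
    excess-∷ X p v l = by-eq p (sym ι1≈1)
      (solve 5 (λ x p s d o → (x :- p) :+ (s :- d :* p) := ((x :+ s) :- (o :+ d) :* p) :+ p :* (o :- con (ℤ.+ 1))) refl (X v) p (sumOver X l) (ι (length l)) 1#)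

    excess-nonneg : ∀ {A : Set} (X : A → Carrier) {p} (l : List A) → (∀ {v} → v ∈ l → p < X v) →
      0# ≈ excess X p l ⊎ 0# < excess X p l
    excess-nonneg X {p} [] _ = inj₁ (solve 1 (λ p → con (ℤ.+ 0) := con (ℤ.+ 0) :- con (ℤ.+ 0) :* p) refl p)
    excess-nonneg X {p} (v ∷ l) above with excess-nonneg X l (above ∘ there)
    ... | inj₁ h = inj₂ (0<-resp (trans (sym (+-identityʳ _)) (trans (+-congˡ h) (excess-∷ X p v l))) (<⇒0<- (above (here ≡.refl))))
    ... | inj₂ h = inj₂ (0<-resp (excess-∷ X p v l) (+-pos (<⇒0<- (above (here ≡.refl))) h))

  module _ {ν} (0<ν : 0# < ν) (ν<1 : ν < 1#) (0<qν : 0# < (q ν)) where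

    private
      0<1-ν : 0# < (ι 1 - ν)
      0<1-ν = 0<-resp (+-congʳ (sym (+-identityʳ 1#))) (<⇒0<- ν<1)

      0<2-ν : 0# < (ι 2 - ν)
      0<2-ν = 0<-resp (sym (+-assoc 1# (ι 1) (- ν))) (+-pos 0<1 0<1-ν)

      -- Eliminating the inner vertex of a leg leaves the factor (2 - ν)(1 - ν) - 1, which is `q ν`.
      end-centre : ∀ {X} → CodeEig ν X → ∀ i → q ν * X (end i) ≈ X centre
      end-centre {X} eig i = by-eq (ι 1) (mid-equation eig i) (by-eq (ι 2 - ν) (end-equation eig i) (by-eq (X (end i)) (sym ι1≈1)
        (solve 5 (λ v w z p o → ((v :* v :- con (ℤ.+ 3) :* v) :+ o) :* w :=
          ((p :+ con (ℤ.+ 1) :* ((con (ℤ.+ 2) :- v) :* z :- (p :+ w))) :+ (con (ℤ.+ 2) :- v) :* ((con (ℤ.+ 1) :- v) :* w :- z)) :+ w :* (o :- con (ℤ.+ 1)))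
          refl ν (X (end i)) (X (mid i)) (X centre) 1#)))

    -- All neighbours of the centre carry larger values than the centre, contradicting the equation there.
    ¬positive-centre : ∀ {X} → CodeEig ν X → ¬ (0# < X centre)
    ¬positive-centre {X} eig 0<p = [ (λ h → <⇒≉ 0<νp (trans (sym total) (trans (+-congˡ (sym h)) (+-identityʳ _)))) , (λ h → <-irrefl 0# (0<-resp total (+-pos 0<νp h))) ]′
      (excess-nonneg X (nbrs centre) above)
      where
      p = X centre
      l = nbrs {k} centre
      0<νp : 0# < (ν * p)
      0<νp = *-pos 0<ν 0<p
      total : ν * p + excess X p l ≈ 0#
      total = trans (+-congʳ (sym (eig centre))) (solve 3 (λ d p s → (d :* p :- s) :+ (s :- d :* p) := con (ℤ.+ 0)) refl (ι (length l)) p (sumOver X l))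
      -- The difference is ν times the value at the tip, and p = (1 - ν) times that value makes it
      -- positive.
      above-tip : p < X tip
      above-tip = 0<-⇒< (0<-resp (by-eq (- ι 1) (tip-equation eig)
        (solve 3 (λ v x p → v :* x := (x :- p) :+ (:- con (ℤ.+ 1)) :* ((con (ℤ.+ 1) :- v) :* x :- p)) refl ν (X tip) p))
        (*-pos 0<ν (*-pos-cancel 0<1-ν (0<-resp (sym (tip-equation eig)) 0<p))))
      -- With w the outer value, the inner one is (1 - ν)w and p is (ν² - 3ν + 1)w, so they differ
      -- by ν(2 - ν)w.
      above-mid : ∀ i → p < X (mid i)
      above-mid i = 0<-⇒< (0<-resp (by-eq (ι 1) (end-equation eig i) (by-eq (- ι 1) (end-centre eig i) (by-eq w (sym ι1≈1)
        (solve 5 (λ v z w p o → v :* ((con (ℤ.+ 2) :- v) :* w) :=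
          (((z :- p) :+ con (ℤ.+ 1) :* ((con (ℤ.+ 1) :- v) :* w :- z)) :+ (:- con (ℤ.+ 1)) :* (((v :* v :- con (ℤ.+ 3) :* v) :+ o) :* w :- p)) :+ w :* (o :- con (ℤ.+ 1)))
          refl ν (X (mid i)) w p 1#))))
        (*-pos 0<ν (*-pos 0<2-ν (*-pos-cancel 0<qν (0<-resp (sym (end-centre eig i)) 0<p)))))
        where w = X (end i)
      above : ∀ {y} → y ∈ l → p < X y
      above (here ≡.refl) = above-tip
      above (there y∈) with ∈-map⁻ mid y∈
      ... | i , _ , ≡.refl = above-mid i

    private
      sumOver-neg : ∀ {A : Set} (X : A → Carrier) l → sumOver (λ y → - X y) l ≈ - sumOver X l
      sumOver-neg X []      = solve 0 (con (ℤ.+ 0) := :- con (ℤ.+ 0)) refl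
      sumOver-neg X (v ∷ l) = trans (+-congˡ (sumOver-neg X l)) (solve 2 (λ x y → (:- x) :- y := :- (x :+ y)) refl (X v) (sumOver X l))

      CodeEig-neg : ∀ {X} → CodeEig ν X → CodeEig ν (λ y → - X y)
      CodeEig-neg {X} eig y = trans (+-congˡ (-‿cong (sumOver-neg X (nbrs y)))) (by-eq (- ι 1) (eig y)
        (solve 4 (λ d v x s → d :* (:- x) :- (:- s) := v :* (:- x) :+ (:- con (ℤ.+ 1)) :* ((d :* x :- s) :- v :* x)) refl
          (ι (length (nbrs y))) ν (X y) (sumOver X (nbrs y))))

      -- Neither `q ν` nor 1 - ν vanishes, so every branch is determined by the value at the centre.
      zero-centre : ∀ {X} → CodeEig ν X → X centre ≈ 0# → ∀ y → X y ≈ 0#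
      zero-centre {X} eig p≈0 = at
        where
        pos≉0 : ∀ {x} → 0# < x → x ≉0
        pos≉0 0<x x≈0 = <⇒≉ 0<x (sym x≈0)
        ends : ∀ i → X (end i) ≈ 0#
        ends i = *-cancel-0 (pos≉0 0<qν) (trans (end-centre eig i) p≈0)
        at : ∀ y → X y ≈ 0#
        at centre  = p≈0
        at tip     = *-cancel-0 (pos≉0 0<1-ν) (trans (tip-equation eig) p≈0)
        at (mid i) = trans (sym (end-equation eig i)) (trans (*-congˡ (ends i)) (zeroʳ _))
        at (end i) = ends i

    ¬eigenvalue : ¬ IsLapEigenvalue F G ν
    ¬eigenvalue (x , eig′ , x≉0) with <-trichot 0# (x (decode centre))
    ... | inj₁ h        = ¬positive-centre (eigenvector⇒code eig′) h
    ... | inj₂ (inj₁ h) = x≉0 (vanish (zero-centre (eigenvector⇒code eig′) (sym h)))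
    ... | inj₂ (inj₂ h) = ¬positive-centre (CodeEig-neg (eigenvector⇒code eig′)) (neg-pos h)

  smaller-root-connectivity : ∀ {a} → q a ≈ 0# → ¬ ((ι 3 - a) < a) → IsLapEigenvalue F G a → IsAlgebraicConnectivity F G a
  smaller-root-connectivity qa a≤ eigenvalue = eigenvalue , 0<root ,
    λ ν eigν 0<ν ν<a → ¬eigenvalue 0<ν (below-1 ν<a) (q-pos ν<a) eigν
    where open SmallerRoot qa a≤

-- The equivalence and the algebraic connectivity of the extremal tree

module Main {c ℓ} (F : OrderedField c ℓ) {n} {T : Graph n} (tree : IsTree T) (8≤n : 8 ≤ℕ n) where
  open FieldKit F
  open LinAlg F
  open Order F

  extremal⇒spider : ∀ {μ} → ¬ μ ≈ 1# → ∀ {m} → HasIndepEigenvectors F T μ m → n ≡ 2 *ℕ m +ℕ 4 →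
    ∃ λ k → n ≡ 2 *ℕ suc k × Coding (adj T) k × q μ ≈ 0#
  extremal⇒spider {μ} μ≉1 vecs n≡ with RootedTree.spider-rooted F μ μ≉1 tree vecs n≡ 8≤n
  ... | r , ts , rep , ll , hQ = _ , spider-order tree rep ll , spider⇒coding tree rep ll , hQ

  private
    large : ∀ k → n ≡ 2 *ℕ suc k → ∃ λ j → k ≡ suc (suc j)
    large 0 n≡ with s≤s (s≤s ()) ← ≡.subst (8 ≤ℕ_) n≡ 8≤n
    large 1 n≡ with s≤s (s≤s (s≤s (s≤s ()))) ← ≡.subst (8 ≤ℕ_) n≡ 8≤n
    large (suc (suc j)) _ = j , ≡.refl

    root≉1 : ∀ {μ} → q μ ≈ 0# → ¬ μ ≈ 1#
    root≉1 qμ μ≈1 = <⇒≉ q1<0 (trans (q-cong (sym μ≈1)) qμ)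

    indep⇒eigenvalue : ∀ {μ k} → HasIndepEigenvectors F T μ (suc k) → IsLapEigenvalue F T μ
    indep⇒eigenvalue {k = k} (vs , eig , ind) = vs fzero , eig fzero , λ zero-vector →
      0≉1 (sym (ind first (λ j → trans (+-cong (trans (*-congˡ (zero-vector j)) (zeroʳ 1#)) (∑-zero {k} λ i → zeroˡ (vs (fsuc i) j))) (+-identityˡ 0#)) fzero))
      where
      first : ∀ {k} → Fin (suc k) → Carrier
      first fzero    = 1#
      first (fsuc _) = 0#

  -- The k long legs yield k - 1 independent differences, and the forcing set of k - 1 inner
  -- vertices shows that there are no more; so m = k - 1 with n = 2(k + 1).
  spider⇒multiplicity : ∀ {μ k m} → n ≡ 2 *ℕ suc k → Coding (adj T) k → q μ ≈ 0# → LapMultiplicity F T μ m → n ≡ 2 *ℕ m +ℕ 4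
  spider⇒multiplicity {μ} {k} {m} n≡ coding qμ mult with large k n≡
  ... | j , ≡.refl = ≡.trans n≡ (≡.trans (arith j) (≡.cong (λ m → 2 *ℕ m +ℕ 4) (ℕₚ.≤-antisym
    (multiplicity≥ T μ mult (independent-eigenvectors qμ)) (multiplicity-≤ (proj₁ mult)))))
    where
    open SpiderMultiplicity F {G = T} coding {μ} (root≉1 qμ)
    arith : ∀ j → 2 *ℕ suc (suc (suc j)) ≡ 2 *ℕ suc j +ℕ 4
    arith = solve-∀

  spider⇒eigenvalue : ∀ {μ k} → n ≡ 2 *ℕ suc k → Coding (adj T) k → q μ ≈ 0# → IsLapEigenvalue F T μ
  spider⇒eigenvalue {μ} {k} n≡ coding qμ with large k n≡
  ... | j , ≡.refl = indep⇒eigenvalue (SpiderMultiplicity.independent-eigenvectors F {G = T} coding {μ} (root≉1 qμ) qμ)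

  -- Both μ and 3 - μ are roots of `q`, hence eigenvalues. Whichever is not larger is the
  -- connectivity, and the sum 3 expresses that μ is its conjugate in the other case.
  spider⇒connectivity : ∀ {μ k} → n ≡ 2 *ℕ suc k → Coding (adj T) k → q μ ≈ 0# →
    Σ Carrier λ λ₂ → IsAlgebraicConnectivity F T λ₂ × (μ ≈ λ₂ ⊎ μ + λ₂ ≈ ι 3)
  spider⇒connectivity {μ} n≡ coding qμ with <-trichot (ι 3 - μ) μ
  ... | inj₁ h = ι 3 - μ , smaller-root-connectivity (q-conjugate qμ)
          (λ h′ → <-asym h (<-resp-≈ (solve 1 (λ m → con (ℤ.+ 3) :- (con (ℤ.+ 3) :- m) := m) refl μ) refl h′))
          (spider⇒eigenvalue n≡ coding (q-conjugate qμ)) ,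
        inj₂ (solve 1 (λ m → m :+ (con (ℤ.+ 3) :- m) := con (ℤ.+ 3)) refl μ)
    where open SpiderConnectivity F {G = T} coding
  ... | inj₂ h = μ , smaller-root-connectivity qμ
          (λ h′ → [ (λ eq → <⇒≉ h′ eq) , <-asym h′ ]′ h)
          (spider⇒eigenvalue n≡ coding qμ) , inj₁ refl
    where open SpiderConnectivity F {G = T} coding

open import Data.Nat using (ℕ; _≤_; _*_; _+_; _∸_)

theorem4p5 : ∀ {c ℓ} (F : OrderedField c ℓ) (n : ℕ) (T : Graph n) → IsTree T → 8 ≤ n →
    (μ : OrderedField.Carrier F) → IsLapEigenvalue F T μ →
    ¬ (OrderedField._≈_ F μ (OrderedField.1# F)) →
    (m : ℕ) → LapMultiplicity F T μ m →
    ((n ≡ 2 * m + 4) ⇔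
    (Σ ℕ λ h → (n ≡ 2 * h) × Iso (adj T) (spiderAdj h (h ∸ 1)) ×
    OrderedField._≈_ F
    (OrderedField._+_ F (OrderedField._-_ F (OrderedField._*_ F μ μ) (OrderedField._*_ F (OrderedField.ι F 3) μ)) (OrderedField.1# F))
    (OrderedField.0# F)))
    × (n ≡ 2 * m + 4 →
    Σ (OrderedField.Carrier F) λ λ₂ → IsAlgebraicConnectivity F T λ₂ ×
    (OrderedField._≈_ F μ λ₂ ⊎ OrderedField._≈_ F (OrderedField._+_ F μ λ₂) (OrderedField.ι F 3)))
theorem4p5 F n T tree 8≤n μ _ μ≉1 m mult = mk⇔ to from , connectivity
  where
  open Main F tree 8≤n
  to : n ≡ 2 * m + 4 → _
  to n≡ with extremal⇒spider μ≉1 (proj₁ mult) n≡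
  ... | k , n≡2h , coding , qμ = suc k , n≡2h , codings⇒Iso coding (spider-coding k) , qμ
  from : _ → n ≡ 2 * m + 4
  from (zero , n≡0 , _) with () ← ≡.subst (8 ≤_) n≡0 8≤n
  from (suc k , n≡2h , iso , qμ) = spider⇒multiplicity n≡2h (Iso⇒coding iso (spider-coding k)) qμ mult
  connectivity : n ≡ 2 * m + 4 → _
  connectivity n≡ with extremal⇒spider μ≉1 (proj₁ mult) n≡
  ... | k , n≡2h , coding , qμ = spider⇒connectivity n≡2h coding qμ
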